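{- Let $(E,\mathcal F,\mathcal L)$ be an oriented interval greedoid with lattice of flats $\Phi$, and let $A_1>A_2>\dots>A_{k+1}=\hat0$ be a chain in $\Phi$. Then the number of tuples $(\alpha_1,\dots,\alpha_{k+1})$ of elements of $\mathcal L$ with $\alpha_1>\alpha_2>\dots>\alpha_{k+1}$ and $\mathrm{supp}(\alpha_i)=A_i$ for all $i$ equals $$\prod_{i=1}^k\ \sum_{B\in[A_{i+1},A_i]}|\mu_\Phi(B,A_i)|,$$ where $\mu_\Phi$ is the Möbius function of $\Phi$.
   Context: Interval greedoid: a finite set $E$ and a nonempty family $\mathcal F$ of subsets of $E$ (feasible sets) such that for all $X,Y,Z\in\mathcal F$: (IG1) if $X\neq\emptyset$ there is $x\in X$ with $X\setminus\{x\}\in\mathcal F$; (IG2) if $|X|>|Y|$ there is $x\in X\setminus Y$ with $Y\cup\{x\}\in\mathcal F$; (IG3) if $X\subseteq Y\subseteq Z$, $e\in E\setminus Z$, $X\cup\{e\}\in\mathcal F$ and $Z\cup\{e\}\in\mathcal F$, then $Y\cup\{e\}\in\mathcal F$. For $X\in\mathcal F$ let $\Gamma(X)=\{x\in E\setminus X: X\cup\{x\}\in\mathcal F\}$. $X\sim Y$ iff $\Gamma(X)=\Gamma(Y)$; classes $[X]$ are flats; $\Phi$ is the set of flats ordered by $[X]\le[Y]$ iff there is $Z\subseteq E\setminus Y$ with $Y\cup Z\in\mathcal F$ and $Y\cup Z\sim X$; $\Phi$ is a lattice with top $[\emptyset]$ and bottom $\hat0$. For a flat $A=[X]$: $\Gamma(A)=\Gamma(X)$,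 $\xi(A)=\bigcup_{X'\sim X}X'$. For $S\subseteq E$, $\mu(S)=[X]$, $X$ an inclusion-maximal feasible subset of $S$. Join: $A\vee B=\mu(\xi(A)\cap\xi(B))$. A covector is $\alpha:E\to\{0,+,-,1\}$ such that for some flat $A=\mathrm{supp}(\alpha)$, $\alpha\in\{+,-\}$ on $\Gamma(A)$, $\alpha=0$ on $\xi(A)$, $\alpha=1$ elsewhere. Order on symbols: $0<+<1$, $0<-<1$. $\alpha\le\beta$ iff $\mathrm{supp}\,\alpha\le\mathrm{supp}\,\beta$ and they agree on $\Gamma(\mathrm{supp}\,\alpha)\cap\Gamma(\mathrm{supp}\,\beta)$. Product: with $C=\mathrm{supp}\,\alpha\vee\mathrm{supp}\,\beta$, $(\alpha\circ\beta)(e)=\beta(e)$ if $e\in\Gamma(C)\cup\xi(C)$ and $\beta(e)>\alpha(e)$; $\alpha(e)$ if $e\in\Gamma(C)\cup\xi(C)$ otherwise; $1$ if $e\notin\Gamma(C)\cup\xi(C)$. $-\alpha$ swaps $+,-$; $S(\alpha,\beta)=\{e:\alpha(e)=-\beta(e)\in\{+,-\}\}$. Oriented interval greedoid: $(E,\mathcal F,\mathcal L)$ with $\mathcal L$ a set of covectors satisfying (OG1) $\mathrm{supp}:\mathcal L\to\Phi$ surjective; (OG2) $-\mathcal L=\mathcal L$; (OG3) closed under $\circ$; (OG4) if $\alpha,\beta\in\mathcal L$, $x\in S(\alpha,\beta)$, $(\alpha\circ\beta)(x)\ne1$, then some $\gamma\in\mathcal L$ has $\gamma(x)=0$ and $\gamma(y)=(\alpha\circ\beta)(y)=(\beta\circ\alpha)(y)$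 for all $y\notin S(\alpha,\beta)$ with $(\alpha\circ\beta)(y)\neq1$. -}

module Defs where

open import Data.Nat using (ℕ; zero; suc; _>_)
open import Data.Integer using (ℤ) renaming (_+_ to _+ℤ_; 0ℤ to 0ℤ; 1ℤ to 1ℤ)
open import Data.Bool using (Bool; true; false; not; _∧_)
open import Data.Fin using (Fin; inject₁) renaming (suc to fsuc)
open import Data.Fin.Subset using (Subset; _∈_; _∉_; _⊆_; _∪_; _∩_; ⁅_⁆; ∁; Nonempty; ∣_∣; _-_; inside; outside)
open import Data.Vec using (Vec; lookup; tabulate; map)
open import Data.List using (List; foldr)
import Data.List as L
open import Data.List.Membership.Propositional using () renaming (_∈_ to _∈ₗ_)
open import Data.List.Relation.Unary.Unique.Propositional using (Unique)
open import Data.Product using (Σ; ∃; ∃-syntax; _×_; _,_)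
open import Data.Sum using (_⊎_)
open import Relation.Nullary using (¬_)
open import Relation.Binary.PropositionalEquality using (_≡_; _≢_)
open import Function.Bundles using (_⇔_)

module _ {n : ℕ} (F : Subset n → Bool) where

  Feasible : Subset n → Set
  Feasible X = F X ≡ true

  Γ : Subset n → Subset n
  Γ X = tabulate λ e → not (lookup X e) ∧ F (X ∪ ⁅ e ⁆)

  record IsIntervalGreedoid : Set where
    field
      nonempty : ∃[ X ] Feasible X
      IG1 : ∀ X → Feasible X → Nonempty X → ∃[ x ] (x ∈ X × Feasible (X - x))
      IG2 : ∀ X Y → Feasible X → Feasible Y → ∣ X ∣ > ∣ Y ∣ →
            ∃[ x ] (x ∈ X × x ∉ Y × Feasible (Y ∪ ⁅ x ⁆))
      IG3 : ∀ X Y Z e → Feasible X → Feasible Y → Feasible Z →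
            X ⊆ Y → Y ⊆ Z → e ∉ Z →
            Feasible (X ∪ ⁅ e ⁆) → Feasible (Z ∪ ⁅ e ⁆) → Feasible (Y ∪ ⁅ e ⁆)

  -- Flats.  X ∼ Y iff Γ(X) = Γ(Y), so a flat [X] is identified with
  -- (coded by) the subset Γ(X); distinct flats have distinct codes.
  IsFlat : Subset n → Set
  IsFlat A = ∃[ X ] (Feasible X × Γ X ≡ A)

  _∈ξ_ : Fin n → Subset n → Set
  e ∈ξ A = ∃[ X ] (Feasible X × Γ X ≡ A × e ∈ X)

  _≤Φ_ : Subset n → Subset n → Set
  A ≤Φ B = ∃[ Y ] (Feasible Y × Γ Y ≡ B ×
             ∃[ Z ] (Z ⊆ ∁ Y × Feasible (Y ∪ Z) × Γ (Y ∪ Z) ≡ A))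

  _<Φ_ : Subset n → Subset n → Set
  A <Φ B = A ≤Φ B × A ≢ B

  IsBottom : Subset n → Set
  IsBottom A = IsFlat A × (∀ B → IsFlat B → A ≤Φ B)

-- Signs {0,+,-,1} with 0 < + < 1, 0 < - < 1

data Sign : Set where
  𝟎 ⊕ ⊖ 𝟏 : Sign

negS : Sign → Sign
negS ⊕ = ⊖
negS ⊖ = ⊕
negS s = s

-- pick a b = b if b > a, and a otherwise
pick : Sign → Sign → Sign
pick 𝟎 b = b
pick ⊕ 𝟏 = 𝟏
pick ⊕ _ = ⊕
pick ⊖ 𝟏 = 𝟏
pick ⊖ _ = ⊖
pick 𝟏 _ = 𝟏

isPM : Sign → Bool
isPM ⊕ = true
isPM ⊖ = true
isPM _ = false

Covec : ℕ → Set
Covec n = Vec Sign n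

neg : ∀ {n} → Covec n → Covec n
neg = map negS

-- The (code of the) support flat of a sign vector: the set where it is ±.
-- For a covector α with supp α = A, this set is exactly Γ(A).
supp : ∀ {n} → Covec n → Subset n
supp α = map isPM α

Sep : ∀ {n} → Covec n → Covec n → Fin n → Set
Sep α β e = (lookup α e ≡ ⊕ × lookup β e ≡ ⊖) ⊎ (lookup α e ≡ ⊖ × lookup β e ≡ ⊕)

module _ {n : ℕ} (F : Subset n → Bool) where

  -- α is a covector: for the flat A = supp α, α ∈ {+,-} on Γ(A) (automatic
  -- from the definition of supp), α = 0 exactly on ξ(A), α = 1 elsewhere.
  IsCovector : Covec n → Set
  IsCovector α = IsFlat F (supp α) × (∀ e → (lookup α e ≡ 𝟎) ⇔ (_∈ξ_ F e (supp α)))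

  _≤ᶜ_ : Covec n → Covec n → Set
  α ≤ᶜ β = _≤Φ_ F (supp α) (supp β) ×
           (∀ e → e ∈ supp α → e ∈ supp β → lookup α e ≡ lookup β e)

  _<ᶜ_ : Covec n → Covec n → Set
  α <ᶜ β = α ≤ᶜ β × α ≢ β

  MaxFeasibleIn : (Fin n → Set) → Subset n → Set
  MaxFeasibleIn S X = Feasible F X × (∀ e → e ∈ X → S e) ×
    (∀ Y → Feasible F Y → X ⊆ Y → (∀ e → e ∈ Y → S e) → Y ≡ X)

  -- γ = α ∘ β, where C = supp α ∨ supp β = μ(ξ(supp α) ∩ ξ(supp β)) = [X],
  -- X an inclusion-maximal feasible subset of ξ(supp α) ∩ ξ(supp β).
  IsProduct : Covec n → Covec n → Covec n → Set
  IsProduct α β γ =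
    ∃[ X ] (MaxFeasibleIn (λ e → _∈ξ_ F e (supp α) × _∈ξ_ F e (supp β)) X ×
      (∀ e → (e ∈ Γ F X ⊎ _∈ξ_ F e (Γ F X)) → lookup γ e ≡ pick (lookup α e) (lookup β e)) ×
      (∀ e → ¬ (e ∈ Γ F X ⊎ _∈ξ_ F e (Γ F X)) → lookup γ e ≡ 𝟏))

  record IsOrientedIntervalGreedoid (𝓛 : Covec n → Set) : Set₁ where
    field
      greedoid : IsIntervalGreedoid F
      covectors : ∀ α → 𝓛 α → IsCovector α
      OG1 : ∀ A → IsFlat F A → ∃[ α ] (𝓛 α × supp α ≡ A)
      OG2 : ∀ α → 𝓛 α → 𝓛 (neg α)
      OG3 : ∀ α β γ → 𝓛 α → 𝓛 β → IsProduct α β γ → 𝓛 γ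
      OG4 : ∀ α β x γ₁ γ₂ → 𝓛 α → 𝓛 β → Sep α β x →
            IsProduct α β γ₁ → IsProduct β α γ₂ → lookup γ₁ x ≢ 𝟏 →
            ∃[ γ ] (𝓛 γ × lookup γ x ≡ 𝟎 ×
              (∀ y → ¬ Sep α β y → lookup γ₁ y ≢ 𝟏 →
                 lookup γ y ≡ lookup γ₁ y × lookup γ y ≡ lookup γ₂ y))

Enumerates : ∀ {a} {A : Set a} → List A → (A → Set) → Set a
Enumerates l P = Unique l × (∀ x → (x ∈ₗ l) ⇔ P x)

sumℤ : List ℤ → ℤ
sumℤ = foldr _+ℤ_ 0ℤ

module _ {n : ℕ} (F : Subset n → Bool) where

  InInterval : Subset n → Subset n → Subset n → Set
  InInterval B A C = IsFlat F C × _≤Φ_ F B C × _≤Φ_ F C A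

  IsMobius : (Subset n → Subset n → ℤ) → Set
  IsMobius m = (∀ A → IsFlat F A → m A A ≡ 1ℤ) ×
    (∀ B A → IsFlat F B → IsFlat F A → _<Φ_ F B A →
       ∀ l → Enumerates l (InInterval B A) → sumℤ (L.map (m B) l) ≡ 0ℤ)

{-# OPTIONS --safe #-}
module Submission where

open import Defs
open import Data.Nat using (ℕ; suc)
open import Data.Integer using (ℤ; ∣_∣)
open import Data.Bool using (Bool)
open import Data.Fin using (Fin; inject₁; fromℕ) renaming (suc to fsuc)
open import Data.Fin.Subset using (Subset)
open import Data.Vec using (Vec; lookup)
open import Data.List using (List; length; map; allFin)
open import Data.Nat.ListAction using (sum; product)
open import Data.Product using (_×_)
open import Relation.Binary.PropositionalEquality using (_≡_)

open import Algebra.Structures using (IsCommutativeMonoid)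
open import Data.Bool as Bool using (true; false; not; _∧_)
open import Data.Fin as Fin using () renaming (zero to fzero)
import Data.Fin.Properties as Fin
open import Data.Fin.Subset
  using (_∈_; _∉_; _⊆_; _∪_; _∩_; ⁅_⁆; ∁; Nonempty; _-_) renaming (∣_∣ to ∥_∥)
open import Data.Fin.Subset.Properties
import Data.Integer as ℤ
import Data.Integer.Properties as ℤ
open import Data.List using ([]; _∷_; _++_; foldr; filter; cartesianProductWith)
open import Data.List.Properties using (map-tabulate)
open import Data.List.Membership.Propositional using (lose) renaming (_∈_ to _∈ₗ_)
open import Data.List.Membership.Propositional.Properties
  using (∈-filter⁺; ∈-filter⁻; ∈-cartesianProductWith⁺; ∈-map⁻; ∈-++⁻; ∈-allFin)
open import Data.List.Membership.Propositional.Properties.WithK using (unique∧set⇒bag)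
open import Data.List.Relation.Binary.BagAndSetEquality using (∼bag⇒↭)
open import Data.List.Relation.Binary.Permutation.Propositional using (_↭_; ↭⇒↭ₛ)
open import Data.List.Relation.Binary.Permutation.Propositional.Properties using (map⁺)
open import Data.List.Relation.Binary.Permutation.Setoid.Properties using (foldr-commMonoid)
open import Data.List.Relation.Unary.All as All using (All; []; _∷_)
import Data.List.Relation.Unary.All.Properties as All
open import Data.List.Relation.Unary.AllPairs using ([]; _∷_)
open import Data.List.Relation.Unary.Any as Any using (here; there)
open import Data.List.Relation.Unary.Unique.Propositional using (Unique)
import Data.List.Relation.Unary.Unique.Propositional.Properties as Unique
open import Data.Nat using (zero; _+_; _*_; _≤_; _<_; _>_; s≤s)
import Data.Nat as ℕ
open import Data.Nat.Properties as ℕ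
  using (≤-refl; ≤-trans; ≤-antisym; ≤-reflexive; <-trans; <-≤-trans; n≮n; n<1+n; m≤n⇒m<n∨m≡n;
         ≤-<-connex; m≤n+m; +-suc; +-identityʳ; +-0-isCommutativeMonoid;
         *-zeroʳ; *-identityʳ; *-distribˡ-+)
open import Data.Product using (∃; ∃-syntax; _,_; proj₁; proj₂)
open import Data.Sign as Sgn using (opposite)
import Data.Sign.Properties as Sgn
open import Data.Sum using (_⊎_; inj₁; inj₂; [_,_]′)
open import Data.Vec using ([]; _∷_; zipWith; here; there)
open import Data.Vec.Properties using (∷-injective; ≡-dec; []=⇒lookup; lookup⇒[]=; lookup∘tabulate; lookup-map; lookup-zipWith; tabulate∘lookup; tabulate-cong)
open import Function using (_∘_; id; _⇔_; mk⇔; Equivalence)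
open import Relation.Binary.PropositionalEquality
  using (_≢_; refl; sym; trans; cong; cong₂; subst; setoid; module ≡-Reasoning)
open import Relation.Nullary using (¬_; Dec; yes; no; contradiction)
open import Relation.Nullary.Decidable using (_×-dec_; _→-dec_; ¬?; decidable-stable)
open import Relation.Unary using (Decidable)

open Equivalence using (to; from)

-- Choosing the chain from the bottom up, it is enough to count, for δ ∈ 𝓛 with support D, the
-- α ≥ δ in 𝓛 with support A.  For a list S of elements of Γ(A) ∪ ξ(A) let T(A, S) be the number of
-- sign patterns on S realised by such α, and P(A, S) the sum over B ≥ D of the absolute values of
-- N(B, A, S) = ∑ { m(B, C) : B ≤ C ≤ A, S ⊆ C }.  For e ∈ Γ(A) and A = [X], A′ = [X ∪ {e}], a
-- flat C ≤ A either has e ∈ Γ(C) or lies below A′, so N(B, A, S) = N(B, A, e ∷ S) + N(B, A′, S);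
-- the sign of N(B, A, S) is (-1)^(rank A + rank B), so that P(A, e ∷ S) = P(A, S) + P(A′, S).
-- T obeys the same recursion, as a pattern on S extends by both signs of e exactly when it is
-- realised over A′: elimination gives one direction and composition the other.
-- At S = Γ(A) the equality T = P is the count wanted.

-- The recursion is deletion and restriction for counting regions of an arrangement: dropping `e`
-- from S deletes a hyperplane, passing from A to A′ restricts to it. Greedoid and 𝓛 stay fixed and
-- only the pair (A, S) changes, so no minors have to be constructed. As S is kept while A descends,
-- an element of Γ(A) may fall into ξ(A′); this is why S is drawn from Γ(A) ∪ ξ(A). Once S contains
-- an element of ξ(A), both T and P are 0. The obstacle lies on the greedoid side. A flat is a class
-- of feasible sets, and A′ as well as the order on flats is described through a representative X.
-- Independence of X rests on one fact: Γ(X) determines Γ(X ∪ {z}) for every z in Γ(X). It is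
-- obtained by exchange among feasible sets of maximal size inside the union of two representatives,
-- with IG3 excluding the last case.

lookup-injective : ∀ {A : Set} {n} {xs ys : Vec A n} → (∀ i → lookup xs i ≡ lookup ys i) → xs ≡ ys
lookup-injective {xs = xs} {ys} eq =
  trans (sym (tabulate∘lookup xs)) (trans (tabulate-cong eq) (tabulate∘lookup ys))

-- Signs and sign vectors

_≟ˢ_ : (s t : Sign) → Dec (s ≡ t)
𝟎 ≟ˢ 𝟎 = yes refl
𝟎 ≟ˢ ⊕ = no λ ()
𝟎 ≟ˢ ⊖ = no λ ()
𝟎 ≟ˢ 𝟏 = no λ ()
⊕ ≟ˢ 𝟎 = no λ ()
⊕ ≟ˢ ⊕ = yes refl
⊕ ≟ˢ ⊖ = no λ ()
⊕ ≟ˢ 𝟏 = no λ ()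
⊖ ≟ˢ 𝟎 = no λ ()
⊖ ≟ˢ ⊕ = no λ ()
⊖ ≟ˢ ⊖ = yes refl
⊖ ≟ˢ 𝟏 = no λ ()
𝟏 ≟ˢ 𝟎 = no λ ()
𝟏 ≟ˢ ⊕ = no λ ()
𝟏 ≟ˢ ⊖ = no λ ()
𝟏 ≟ˢ 𝟏 = yes refl

sign : Bool → Sign
sign true = ⊕
sign false = ⊖

pick-sign : ∀ b c → pick (sign b) (sign c) ≡ sign b
pick-sign true  true  = refl
pick-sign true  false = refl
pick-sign false true  = refl
pick-sign false false = refl

negS-sign : ∀ {b c} → b ≢ c → negS (sign b) ≡ sign c
negS-sign {true}  {true}  b≢c = contradiction refl b≢c
negS-sign {true}  {false} b≢c = refl
negS-sign {false} {true}  b≢c = refl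
negS-sign {false} {false} b≢c = contradiction refl b≢c

module _ {n : ℕ} where

  sign⇒supp : ∀ (α : Covec n) {e} b → lookup α e ≡ sign b → e ∈ supp α
  sign⇒supp α {e} b eq = lookup⇒[]= e _ (trans (lookup-map e isPM α) (trans (cong isPM eq) (isPM-sign b)))
    where
    isPM-sign : ∀ b → isPM (sign b) ≡ true
    isPM-sign true  = refl
    isPM-sign false = refl

  isPM-supp : ∀ (α : Covec n) {e} → e ∈ supp α → isPM (lookup α e) ≡ true
  isPM-supp α {e} e∈ = trans (sym (lookup-map e isPM α)) ([]=⇒lookup e∈)

  supp⇒sign : ∀ (α : Covec n) {e} → e ∈ supp α → ∃[ b ] lookup α e ≡ sign b
  supp⇒sign α {e} e∈ = isPM⇒sign _ (isPM-supp α e∈)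
    where
    isPM⇒sign : ∀ s → isPM s ≡ true → ∃[ b ] s ≡ sign b
    isPM⇒sign ⊕ _ = true , refl
    isPM⇒sign ⊖ _ = false , refl

  pick-supp : ∀ (α β : Covec n) {e} → e ∈ supp α → e ∈ supp β → pick (lookup α e) (lookup β e) ≡ lookup α e
  pick-supp α β e∈α e∈β with supp⇒sign α e∈α | supp⇒sign β e∈β
  ... | b , eq | c , eq′ = trans (cong₂ pick eq eq′) (trans (pick-sign b c) (sym eq))

  neither⇒𝟏 : ∀ (α : Covec n) {e} → e ∉ supp α → lookup α e ≢ 𝟎 → lookup α e ≡ 𝟏
  neither⇒𝟏 α {e} e∉ ≢𝟎 = last (lookup α e) refl
    where
    last : ∀ s → lookup α e ≡ s → s ≡ 𝟏
    last 𝟎 eq = contradiction eq ≢𝟎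
    last ⊕ eq = contradiction (sign⇒supp α true eq) e∉
    last ⊖ eq = contradiction (sign⇒supp α false eq) e∉
    last 𝟏 _ = refl

  supp-cong : ∀ (α β : Covec n) → (∀ e → isPM (lookup α e) ≡ isPM (lookup β e)) → supp α ≡ supp β
  supp-cong α β eq = lookup-injective λ e →
    trans (lookup-map e isPM α) (trans (eq e) (sym (lookup-map e isPM β)))

  supp-neg : ∀ (α : Covec n) → supp (neg α) ≡ supp α
  supp-neg α = supp-cong (neg α) α λ e → trans (cong isPM (lookup-map e negS α)) (isPM-negS (lookup α e))
    where
    isPM-negS : ∀ s → isPM (negS s) ≡ isPM s
    isPM-negS 𝟎 = refl
    isPM-negS ⊕ = refl
    isPM-negS ⊖ = refl
    isPM-negS 𝟏 = refl

  Matches : Covec n → List (Fin n × Bool) → Set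
  Matches α = All λ (e , b) → lookup α e ≡ sign b

-- Integers with a prescribed sign

opposite-*ˡ : ∀ σ τ → opposite σ Sgn.* τ ≡ opposite (σ Sgn.* τ)
opposite-*ˡ Sgn.+ Sgn.+ = refl
opposite-*ˡ Sgn.+ Sgn.- = refl
opposite-*ˡ Sgn.- Sgn.+ = refl
opposite-*ˡ Sgn.- Sgn.- = refl

opposite-◃+◃ : ∀ σ q → (opposite σ ℤ.◃ q) ℤ.+ (σ ℤ.◃ q) ≡ ℤ.0ℤ
opposite-◃+◃ Sgn.+ q = trans (cong₂ ℤ._+_ (ℤ.-◃n≡-n q) (ℤ.+◃n≡+n q)) (ℤ.+-inverseˡ (ℤ.+ q))
opposite-◃+◃ Sgn.- q = trans (cong₂ ℤ._+_ (ℤ.+◃n≡+n q) (ℤ.-◃n≡-n q)) (ℤ.+-inverseʳ (ℤ.+ q))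

-- Subtracting a number of the opposite sign adds the magnitudes. This is what turns the difference
-- in the recursion for `N` into a sum of absolute values.
◃-cancel : ∀ {σ x y} p q → x ℤ.+ y ≡ σ ℤ.◃ p → y ≡ opposite σ ℤ.◃ q → x ≡ σ ℤ.◃ (p + q)
◃-cancel {σ} {x} {y} p q x+y≡ y≡ = begin
  x                                        ≡⟨ sym (ℤ.+-identityʳ x) ⟩
  x ℤ.+ ℤ.0ℤ                               ≡⟨ cong (λ z → x ℤ.+ z) (sym (trans (cong (ℤ._+ (σ ℤ.◃ q)) y≡) (opposite-◃+◃ σ q))) ⟩
  x ℤ.+ (y ℤ.+ (σ ℤ.◃ q))                    ≡⟨ sym (ℤ.+-assoc x y _) ⟩
  x ℤ.+ y ℤ.+ (σ ℤ.◃ q)                      ≡⟨ cong (ℤ._+ (σ ℤ.◃ q)) x+y≡ ⟩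
  (σ ℤ.◃ p) ℤ.+ (σ ℤ.◃ q)                      ≡⟨ sym (ℤ.◃-distrib-+ σ p q) ⟩
  σ ℤ.◃ (p + q)                            ∎
  where open ≡-Reasoning

-- Enumerations and finite types

enumerates-↭ : ∀ {A : Set} {P Q : A → Set} {xs ys} → Enumerates xs P → Enumerates ys Q →
  (∀ x → P x ⇔ Q x) → xs ↭ ys
enumerates-↭ (uxs , xs⇔) (uys , ys⇔) P⇔Q =
  ∼bag⇒↭ (unique∧set⇒bag uxs uys λ {x} → mk⇔ (from (ys⇔ x) ∘ to (P⇔Q x) ∘ to (xs⇔ x))
                                              (from (xs⇔ x) ∘ from (P⇔Q x) ∘ to (ys⇔ x)))

record Finite (A : Set) : Set where
  field
    elements : List A
    unique   : Unique elements
    complete : ∀ x → x ∈ₗ elements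

  filter-enumerates : ∀ {P : A → Set} (P? : Decidable P) → Enumerates (filter P? elements) P
  filter-enumerates P? = Unique.filter⁺ P? unique ,
    λ x → mk⇔ (proj₂ ∘ ∈-filter⁻ P? {xs = elements}) (∈-filter⁺ P? (complete x))

  exists? : ∀ {P : A → Set} → Decidable P → Dec (∃ P)
  exists? P? with Any.any? P? elements
  ... | yes any = yes (Any.satisfied any)
  ... | no none = no λ (x , Px) → none (lose (complete x) Px)

  -- Excluded middle holds doubly negated at each point, and double negation passes through the
  -- finite conjunction over `elements`.
  ¬¬-decidable : ∀ (P : A → Set) → ¬ ¬ (Decidable P)
  ¬¬-decidable P k = go elements λ all → k λ x → All.lookup all (complete x)
    where
    go : ∀ xs → ¬ ¬ All (Dec ∘ P) xs
    go [] k = k []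
    go (x ∷ xs) k = go xs λ all → k (no (λ Px → k (yes Px ∷ all)) ∷ all)

Vec-finite : ∀ {A : Set} → Finite A → ∀ n → Finite (Vec A n)
Vec-finite {A} fin = go
  where
  open Finite
  go : ∀ n → Finite (Vec A n)
  go zero .elements = [] ∷ []
  go zero .unique = [] ∷ []
  go zero .complete [] = here refl
  go (suc n) .elements = cartesianProductWith _∷_ (elements fin) (elements (go n))
  go (suc n) .unique = Unique.cartesianProductWith⁺ _∷_ ∷-injective (unique fin) (unique (go n))
  go (suc n) .complete (x ∷ xs) = ∈-cartesianProductWith⁺ _∷_ (complete fin x) (complete (go n) xs)

Bool-finite : Finite Bool
Bool-finite = record
  { elements = false ∷ true ∷ []
  ; unique   = ((λ ()) ∷ []) ∷ [] ∷ []
  ; complete = λ { false → here refl ; true → there (here refl) }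
  }

Sign-finite : Finite Sign
Sign-finite = record
  { elements = 𝟎 ∷ ⊕ ∷ ⊖ ∷ 𝟏 ∷ []
  ; unique   = ((λ ()) ∷ (λ ()) ∷ (λ ()) ∷ []) ∷ ((λ ()) ∷ (λ ()) ∷ []) ∷ ((λ ()) ∷ []) ∷ [] ∷ []
  ; complete = λ { 𝟎 → here refl ; ⊕ → there (here refl) ; ⊖ → there (there (here refl))
                 ; 𝟏 → there (there (there (here refl))) }
  }

-- Finite sums and Iverson brackets

module Summation {M : Set} {_∙_ : M → M → M} {ε : M}
  (isCommutativeMonoid : IsCommutativeMonoid _≡_ _∙_ ε) where

  open IsCommutativeMonoid isCommutativeMonoid
    using (assoc; comm; identityˡ; identityʳ)

  ∑ : ∀ {I : Set} → List I → (I → M) → M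
  ∑ is f = foldr _∙_ ε (map f is)

  -- Iverson bracket
  [_]·_ : ∀ {P : Set} → Dec P → M → M
  [ yes _ ]· v = v
  [ no _ ]· v = ε

  private variable
    I J P Q R T : Set

  ∑-cong-∈ : ∀ (is : List I) {f g : I → M} → (∀ {i} → i ∈ₗ is → f i ≡ g i) → ∑ is f ≡ ∑ is g
  ∑-cong-∈ [] f≗g = refl
  ∑-cong-∈ (i ∷ is) f≗g = cong₂ _∙_ (f≗g (here refl)) (∑-cong-∈ is (f≗g ∘ there))

  ∑-cong : ∀ (is : List I) {f g : I → M} → (∀ i → f i ≡ g i) → ∑ is f ≡ ∑ is g
  ∑-cong is f≗g = ∑-cong-∈ is λ {i} _ → f≗g i

  ∑-ε : ∀ (is : List I) {f : I → M} → (∀ i → f i ≡ ε) → ∑ is f ≡ ε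
  ∑-ε [] f≗ε = refl
  ∑-ε (i ∷ is) f≗ε = trans (cong₂ _∙_ (f≗ε i) (∑-ε is f≗ε)) (identityˡ ε)

  interchange : ∀ a b c d → (a ∙ b) ∙ (c ∙ d) ≡ (a ∙ c) ∙ (b ∙ d)
  interchange a b c d = begin
    (a ∙ b) ∙ (c ∙ d) ≡⟨ assoc a b (c ∙ d) ⟩
    a ∙ (b ∙ (c ∙ d)) ≡⟨ cong (a ∙_) (trans (sym (assoc b c d)) (trans (cong (_∙ d) (comm b c)) (assoc c b d))) ⟩
    a ∙ (c ∙ (b ∙ d)) ≡⟨ sym (assoc a c (b ∙ d)) ⟩
    (a ∙ c) ∙ (b ∙ d) ∎
    where open ≡-Reasoning

  ∑-∙ : ∀ (is : List I) (f g : I → M) → ∑ is (λ i → f i ∙ g i) ≡ ∑ is f ∙ ∑ is g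
  ∑-∙ [] f g = sym (identityˡ ε)
  ∑-∙ (i ∷ is) f g = trans (cong ((f i ∙ g i) ∙_) (∑-∙ is f g)) (interchange _ _ _ _)

  ∑-swap : ∀ (is : List I) (js : List J) (f : I → J → M) →
    ∑ is (λ i → ∑ js (f i)) ≡ ∑ js (λ j → ∑ is (λ i → f i j))
  ∑-swap [] js f = sym (∑-ε js λ _ → refl)
  ∑-swap (i ∷ is) js f = trans (cong (∑ js (f i) ∙_) (∑-swap is js f)) (sym (∑-∙ js (f i) _))

  ∑-++ : ∀ (is js : List I) (f : I → M) → ∑ (is ++ js) f ≡ ∑ is f ∙ ∑ js f
  ∑-++ [] js f = sym (identityˡ _)
  ∑-++ (i ∷ is) js f = trans (cong (f i ∙_) (∑-++ is js f)) (sym (assoc _ _ _))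

  ∑-map : ∀ (h : J → I) (js : List J) (f : I → M) → ∑ (map h js) f ≡ ∑ js (f ∘ h)
  ∑-map h [] f = refl
  ∑-map h (j ∷ js) f = cong (f (h j) ∙_) (∑-map h js f)

  ∑-cartesianProductWith : ∀ {K : Set} (h : I → J → K) is js (f : K → M) →
    ∑ (cartesianProductWith h is js) f ≡ ∑ is (λ i → ∑ js (f ∘ h i))
  ∑-cartesianProductWith h [] js f = refl
  ∑-cartesianProductWith h (i ∷ is) js f = trans (∑-++ (map (h i) js) _ f)
    (cong₂ _∙_ (∑-map (h i) js f) (∑-cartesianProductWith h is js f))

  []·-yes : (d : Dec P) {v : M} → P → [ d ]· v ≡ v
  []·-yes (yes _) p = refl
  []·-yes (no ¬p) p = contradiction p ¬p

  []·-no : (d : Dec P) {v : M} → ¬ P → [ d ]· v ≡ ε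
  []·-no (yes p) ¬p = contradiction p ¬p
  []·-no (no _) ¬p = refl

  []·-cong : (d : Dec P) (e : Dec Q) {v : M} → (P → Q) → (Q → P) → [ d ]· v ≡ [ e ]· v
  []·-cong (yes p) e P→Q Q→P = sym ([]·-yes e (P→Q p))
  []·-cong (no ¬p) e P→Q Q→P = sym ([]·-no e (¬p ∘ Q→P))

  []·-⊎ : (d : Dec P) (e : Dec Q) (f : Dec R) {v : M} →
    (P → Q ⊎ R) → (Q → P) → (R → P) → (Q → ¬ R) → [ d ]· v ≡ ([ e ]· v) ∙ ([ f ]· v)
  []·-⊎ (no ¬p) e f _ Q→P R→P _ =
    sym (trans (cong₂ _∙_ ([]·-no e (¬p ∘ Q→P)) ([]·-no f (¬p ∘ R→P))) (identityˡ ε))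
  []·-⊎ (yes p) e f P→ _ _ disj with P→ p
  ... | inj₁ q = sym (trans (cong₂ _∙_ ([]·-yes e q) ([]·-no f (disj q))) (identityʳ _))
  ... | inj₂ r = sym (trans (cong₂ _∙_ ([]·-no e (λ q → disj q r)) ([]·-yes f r)) (identityˡ _))

  -- Inclusion and exclusion for two events: `R` is their union, `T` their intersection.
  []·-exchange : (d : Dec P) (e : Dec Q) (f : Dec R) (g : Dec T) {v : M} →
    (P → R) → (Q → R) → (R → P ⊎ Q) → (P → Q → T) → (T → P × Q) →
    ([ d ]· v) ∙ ([ e ]· v) ≡ ([ f ]· v) ∙ ([ g ]· v)
  []·-exchange (yes p) (yes q) f g P→R _ _ PQ→T _ =
    sym (cong₂ _∙_ ([]·-yes f (P→R p)) ([]·-yes g (PQ→T p q)))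
  []·-exchange (yes p) (no ¬q) f g P→R _ _ _ T→PQ =
    sym (cong₂ _∙_ ([]·-yes f (P→R p)) ([]·-no g (¬q ∘ proj₂ ∘ T→PQ)))
  []·-exchange (no ¬p) (yes q) f g _ Q→R _ _ T→PQ = trans (comm _ _)
    (sym (cong₂ _∙_ ([]·-yes f (Q→R q)) ([]·-no g (¬p ∘ proj₁ ∘ T→PQ))))
  []·-exchange (no ¬p) (no ¬q) f g _ _ R→ _ T→PQ =
    sym (cong₂ _∙_ ([]·-no f ([ ¬p , ¬q ]′ ∘ R→)) ([]·-no g (¬p ∘ proj₁ ∘ T→PQ)))

  ∑-filter : ∀ {P : I → Set} (P? : Decidable P) is (f : I → M) →
    ∑ (filter P? is) f ≡ ∑ is (λ i → [ P? i ]· f i)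
  ∑-filter P? [] f = refl
  ∑-filter P? (i ∷ is) f with P? i
  ... | yes _ = cong (f i ∙_) (∑-filter P? is f)
  ... | no  _ = trans (∑-filter P? is f) (sym (identityˡ _))

  ∑-↭ : ∀ {is js : List I} (f : I → M) → is ↭ js → ∑ is f ≡ ∑ js f
  ∑-↭ f is↭js = foldr-commMonoid (setoid M) isCommutativeMonoid (↭⇒↭ₛ (map⁺ f is↭js))

  module _ (fin : Finite I) where
    open Finite fin

    ∑-enumerates : ∀ {P : I → Set} (P? : Decidable P) {is} → Enumerates is P → (f : I → M) →
      ∑ is f ≡ ∑ elements (λ i → [ P? i ]· f i)
    ∑-enumerates P? enum f =
      trans (∑-↭ f (enumerates-↭ enum (filter-enumerates P?) λ _ → mk⇔ id id)) (∑-filter P? elements f)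

    ∑-single : ∀ {P : I → Set} (P? : Decidable P) {i} → P i → (∀ {j} → P j → j ≡ i) → (f : I → M) →
      ∑ elements (λ i → [ P? i ]· f i) ≡ f i
    ∑-single P? {i} Pi unique-i f = trans (sym (∑-enumerates P?
      (([] ∷ []) , λ j → mk⇔ (λ { (here refl) → Pi }) (here ∘ unique-i)) f)) (identityʳ _)

open Summation +-0-isCommutativeMonoid

∑-*ˡ : ∀ {I : Set} c (is : List I) f → ∑ is (λ i → c * f i) ≡ c * ∑ is f
∑-*ˡ c [] f = sym (*-zeroʳ c)
∑-*ˡ c (i ∷ is) f = trans (cong (c * f i +_) (∑-*ˡ c is f)) (sym (*-distribˡ-+ c (f i) _))

length≡∑ : ∀ {I : Set} (is : List I) → length is ≡ ∑ is (λ _ → 1)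
length≡∑ [] = refl
length≡∑ (i ∷ is) = cong suc (length≡∑ is)

-- Adjoining one element to a subset

infixl 6 _▹_
_▹_ : ∀ {n} → Subset n → Fin n → Subset n
X ▹ e = X ∪ ⁅ e ⁆

module _ {n : ℕ} where

  ⊆-▹ : ∀ (X : Subset n) e → X ⊆ X ▹ e
  ⊆-▹ X e = p⊆p∪q ⁅ e ⁆

  ∈-▹ : ∀ (X : Subset n) e → e ∈ X ▹ e
  ∈-▹ X e = q⊆p∪q X ⁅ e ⁆ (x∈⁅x⁆ e)

  ∈-▹⁻ : ∀ (X : Subset n) e {x} → x ∈ X ▹ e → x ∈ X ⊎ x ≡ e
  ∈-▹⁻ X e x∈ with x∈p∪q⁻ X ⁅ e ⁆ x∈
  ... | inj₁ x∈X = inj₁ x∈X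
  ... | inj₂ x∈e = inj₂ (x∈⁅y⁆⇒x≡y e x∈e)

  ▹-⊆ : ∀ {X Y : Subset n} {e} → X ⊆ Y → e ∈ Y → X ▹ e ⊆ Y
  ▹-⊆ {X} {Y} {e} X⊆Y e∈Y x∈ with ∈-▹⁻ X e x∈
  ... | inj₁ x∈X = X⊆Y x∈X
  ... | inj₂ refl = e∈Y

  ▹-comm : ∀ (X : Subset n) e f → X ▹ e ▹ f ≡ X ▹ f ▹ e
  ▹-comm X e f = ⊆-antisym (swap e f) (swap f e)
    where
    swap : ∀ e f → X ▹ e ▹ f ⊆ X ▹ f ▹ e
    swap e f = ▹-⊆ (▹-⊆ (⊆-trans (⊆-▹ X f) (⊆-▹ (X ▹ f) e)) (∈-▹ (X ▹ f) e))
                   (⊆-▹ (X ▹ f) e (∈-▹ X f))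

∥X▹e∥ : ∀ {n} (X : Subset n) e → e ∉ X → ∥ X ▹ e ∥ ≡ suc ∥ X ∥
∥X▹e∥ (true  ∷ X) fzero e∉X = contradiction here e∉X
∥X▹e∥ (false ∷ X) fzero e∉X = cong (suc ∘ ∥_∥) (∪-identityʳ X)
∥X▹e∥ (true  ∷ X) (fsuc e) e∉X = cong suc (∥X▹e∥ X e (e∉X ∘ there))
∥X▹e∥ (false ∷ X) (fsuc e) e∉X = ∥X▹e∥ X e (e∉X ∘ there)

⊆∧≥⇒≡ : ∀ {n} {X Y : Subset n} → X ⊆ Y → ∥ Y ∥ ≤ ∥ X ∥ → X ≡ Y
⊆∧≥⇒≡ {X = X} {Y} X⊆Y ∥Y∥≤∥X∥ = ⊆-antisym X⊆Y Y⊆X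
  where
  Y⊆X : Y ⊆ X
  Y⊆X {x} x∈Y with x ∈? X
  ... | yes x∈X = x∈X
  ... | no  x∉X = contradiction (<-≤-trans (p⊂q⇒∣p∣<∣q∣ (X⊆Y , x , x∈Y , x∉X)) ∥Y∥≤∥X∥) (n≮n _)

-- Exchange in interval greedoids

module IntervalGreedoid {n : ℕ}
  (Feas : Subset n → Set)
  (Feas? : Decidable Feas)
  (G : Subset n → Subset n)
  (∈G⁺ : ∀ {X e} → e ∉ X → Feas (X ▹ e) → e ∈ G X)
  (∈G⁻ : ∀ {X e} → e ∈ G X → e ∉ X × Feas (X ▹ e))
  (IG1 : ∀ X → Feas X → Nonempty X → ∃[ x ] (x ∈ X × Feas (X - x)))
  (IG2 : ∀ X Y → Feas X → Feas Y → ∥ X ∥ > ∥ Y ∥ → ∃[ x ] (x ∈ X × x ∉ Y × Feas (Y ▹ x)))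
  (IG3 : ∀ X Y Z e → Feas X → Feas Y → Feas Z → X ⊆ Y → Y ⊆ Z → e ∉ Z →
         Feas (X ▹ e) → Feas (Z ▹ e) → Feas (Y ▹ e))
  where

  ∥▹∥ : ∀ {X e} → e ∈ G X → ∥ X ▹ e ∥ ≡ suc ∥ X ∥
  ∥▹∥ {X} {e} e∈Γ = ∥X▹e∥ X e (proj₁ (∈G⁻ e∈Γ))

  augment : ∀ {X Y} → Feas X → Feas Y → ∥ Y ∥ < ∥ X ∥ → ∃[ x ] (x ∈ X × x ∈ G Y)
  augment {X} {Y} FX FY lt with IG2 X Y FX FY lt
  ... | x , x∈X , x∉Y , Fx = x , x∈X , ∈G⁺ x∉Y Fx

  -- The fuel `k` bounds how much smaller `X` still is than `Y`. Every augmentation takes its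
  -- element from `Y`, which keeps `T` inside `X ∪ Y`.
  maximal-above : ∀ k {X Y} → Feas X → Feas Y → ∥ X ∥ ≤ ∥ Y ∥ → ∥ Y ∥ ≤ ∥ X ∥ + k →
    ∃[ T ] (Feas T × X ⊆ T × T ⊆ X ∪ Y × ∥ T ∥ ≡ ∥ Y ∥)
  maximal-above zero {X} {Y} FX FY le ge = X , FX , id , p⊆p∪q Y ,
    ≤-antisym le (subst (∥ Y ∥ ≤_) (+-identityʳ _) ge)
  maximal-above (suc k) {X} {Y} FX FY le ge with m≤n⇒m<n∨m≡n le
  ... | inj₂ eq = X , FX , id , p⊆p∪q Y , eq
  ... | inj₁ lt with augment FY FX lt
  ... | x , x∈Y , x∈Γ with maximal-above k {X ▹ x} {Y} (proj₂ (∈G⁻ x∈Γ)) FY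
          (subst (_≤ ∥ Y ∥) (sym (∥▹∥ x∈Γ)) lt)
          (subst (λ j → ∥ Y ∥ ≤ j + k) (sym (∥▹∥ x∈Γ))
             (subst (∥ Y ∥ ≤_) (+-suc ∥ X ∥ k) ge))
  ... | T , FT , Xx⊆T , T⊆ , eq = T , FT , ⊆-trans (⊆-▹ X x) Xx⊆T , T⊆X∪Y , eq
    where
    T⊆X∪Y : T ⊆ X ∪ Y
    T⊆X∪Y t∈T with x∈p∪q⁻ (X ▹ x) Y (T⊆ t∈T)
    ... | inj₁ t∈Xx = ▹-⊆ (p⊆p∪q Y) (q⊆p∪q X Y x∈Y) t∈Xx
    ... | inj₂ t∈Y = q⊆p∪q X Y t∈Y

  extend : ∀ {X Y} → Feas X → Feas Y → ∥ X ∥ ≤ ∥ Y ∥ →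
    ∃[ T ] (Feas T × X ⊆ T × T ⊆ X ∪ Y × ∥ T ∥ ≡ ∥ Y ∥)
  extend {X} {Y} FX FY le = maximal-above ∥ Y ∥ FX FY le (m≤n+m ∥ Y ∥ ∥ X ∥)

  -- Strip `U` one element at a time by `IG1`; the set reached just after `u` is removed is `P`.
  predecessor : ∀ k {U u} → ∥ U ∥ < k → Feas U → u ∈ U →
    ∃[ P ] (Feas P × P ⊆ U × u ∉ P × Feas (P ▹ u))
  predecessor (suc k) {U} {u} (s≤s ∥U∥≤k) FU u∈U with IG1 U FU (u , u∈U)
  ... | x , x∈U , FU-x with x Fin.≟ u
  ... | yes refl = U - u , FU-x , p─q⊆p U ⁅ u ⁆ , u∉ , subst Feas eq FU
    where
    u∉ : u ∉ U - u
    u∉ u∈ = n≮n _ (<-≤-trans (x∈p⇒∣p-x∣<∣p∣ x∈U) (p⊆q⇒∣p∣≤∣q∣ {p = U} {U - u} U⊆))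
      where
      U⊆ : U ⊆ U - u
      U⊆ {y} y∈ with y Fin.≟ u
      ... | yes refl = u∈
      ... | no y≢u = x∈p∧x≢y⇒x∈p-y y∈ y≢u
    eq : U ≡ (U - u) ▹ u
    eq = ⊆-antisym U⊆ (▹-⊆ (p─q⊆p U ⁅ u ⁆) x∈U)
      where
      U⊆ : U ⊆ (U - u) ▹ u
      U⊆ {y} y∈ with y Fin.≟ u
      ... | yes refl = ∈-▹ (U - u) u
      ... | no y≢u = ⊆-▹ (U - u) u (x∈p∧x≢y⇒x∈p-y y∈ y≢u)
  ... | no x≢u with predecessor k (<-≤-trans (x∈p⇒∣p-x∣<∣p∣ x∈U) ∥U∥≤k) FU-x
                       (x∈p∧x≢y⇒x∈p-y u∈U (x≢u ∘ sym))
  ... | P , FP , P⊆ , u∉P , FPu = P , FP , ⊆-trans P⊆ (p─q⊆p U ⁅ x ⁆) , u∉P , FPu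

  -- Descent on ∥ U ∪ V ∥: a feasible P ⊆ U that u extends is completed from V to T,
  -- and the pair (V , T) is again a counterexample, T ∪ V missing u.
  no-detour : ∀ k {M U V z u} → (∀ {T} → Feas T → T ⊆ M → ∥ T ∥ ≤ ∥ V ∥) →
    ∥ U ∪ V ∥ < k → U ⊆ M → V ⊆ M → Feas U → Feas V →
    z ∉ M → u ∈ U → u ∉ V → ¬ Feas (V ▹ z ▹ u)
  no-detour (suc k) {M} {U} {V} {z} {u} max (s≤s ∥U∪V∥≤k) U⊆M V⊆M FU FV z∉M u∈U u∉V FVzu
    with predecessor (suc ∥ U ∥) ≤-refl FU u∈U
  ... | P , FP , P⊆U , u∉P , FPu with extend FP FV (max FP (⊆-trans P⊆U U⊆M))
  ... | T , FT , P⊆T , T⊆P∪V , ∥T∥≡∥V∥ = step₂ (augment FVzu FTz ∥Tz∥<)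
    where
    T⊆M : T ⊆ M
    T⊆M t∈T = [ U⊆M ∘ P⊆U , V⊆M ]′ (x∈p∪q⁻ P V (T⊆P∪V t∈T))

    u∉T : u ∉ T
    u∉T u∈T = [ u∉P , u∉V ]′ (x∈p∪q⁻ P V (T⊆P∪V u∈T))

    z≢u : z ≢ u
    z≢u refl = z∉M (U⊆M u∈U)

    ∥Vzu∥ : ∥ V ▹ z ▹ u ∥ ≡ suc (suc ∥ T ∥)
    ∥Vzu∥ = trans (∥X▹e∥ (V ▹ z) u ([ u∉V , z≢u ∘ sym ]′ ∘ ∈-▹⁻ V z))
                  (cong suc (trans (∥X▹e∥ V z (z∉M ∘ V⊆M)) (cong suc (sym ∥T∥≡∥V∥))))

    saturated : ∀ {x} → x ∈ M → x ∉ G T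
    saturated {x} x∈M x∈Γ = n≮n ∥ V ∥ (subst (_≤ ∥ V ∥) (trans (∥▹∥ x∈Γ) (cong suc ∥T∥≡∥V∥))
                                       (max (proj₂ (∈G⁻ x∈Γ)) (▹-⊆ T⊆M x∈M)))

    -- `T` has the maximal size inside `M`, so among the elements of `V ▹ z ▹ u` only `z` can
    -- augment it.
    step₁ : ∃[ w ] (w ∈ V ▹ z ▹ u × w ∈ G T) → Feas (T ▹ z)
    step₁ (w , w∈ , w∈Γ) with ∈-▹⁻ (V ▹ z) u w∈
    ... | inj₂ refl = contradiction w∈Γ (saturated (U⊆M u∈U))
    ... | inj₁ w∈Vz with ∈-▹⁻ V z w∈Vz
    ... | inj₁ w∈V = contradiction w∈Γ (saturated (V⊆M w∈V))
    ... | inj₂ refl = proj₂ (∈G⁻ w∈Γ)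

    FTz : Feas (T ▹ z)
    FTz = step₁ (augment FVzu FT (subst (∥ T ∥ <_) (sym ∥Vzu∥) (<-trans (n<1+n _) (n<1+n _))))

    ∥Tz∥< : ∥ T ▹ z ∥ < ∥ V ▹ z ▹ u ∥
    ∥Tz∥< = subst (suc ∥ T ▹ z ∥ ≤_) (sym ∥Vzu∥) (s≤s (≤-reflexive (∥X▹e∥ T z (z∉M ∘ T⊆M))))

    u∉Tz : u ∉ T ▹ z
    u∉Tz = [ u∉T , z≢u ∘ sym ]′ ∘ ∈-▹⁻ T z

    smaller : ∥ V ∪ T ∥ < k
    smaller = <-≤-trans (p⊂q⇒∣p∣<∣q∣ {p = V ∪ T} {U ∪ V}
                (VT⊆UV , u , p⊆p∪q V u∈U , ([ u∉V , u∉T ]′ ∘ x∈p∪q⁻ V T))) ∥U∪V∥≤k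
      where
      VT⊆UV : V ∪ T ⊆ U ∪ V
      VT⊆UV x∈ with x∈p∪q⁻ V T x∈
      ... | inj₁ x∈V = q⊆p∪q U V x∈V
      ... | inj₂ x∈T = [ p⊆p∪q V ∘ P⊆U , q⊆p∪q U V ]′ (x∈p∪q⁻ P V (T⊆P∪V x∈T))

    step₂ : ¬ (∃[ w ] (w ∈ V ▹ z ▹ u × w ∈ G (T ▹ z)))
    step₂ (w , w∈ , w∈Γ) with ∈-▹⁻ (V ▹ z) u w∈
    -- `IG3` along `P ⊆ T ⊆ T ▹ z` makes `T ▹ u` feasible, a subset of `M` larger than `V`.
    ... | inj₂ refl = saturated (U⊆M u∈U) (∈G⁺ u∉T
                        (IG3 P T (T ▹ z) u FP FT FTz P⊆T (⊆-▹ T z) u∉Tz FPu (proj₂ (∈G⁻ w∈Γ))))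
    ... | inj₁ w∈Vz with ∈-▹⁻ V z w∈Vz
    ... | inj₂ refl = proj₁ (∈G⁻ w∈Γ) (∈-▹ T z)
    ... | inj₁ w∈V = no-detour k (λ {T′} FT′ T′⊆M → subst (∥ T′ ∥ ≤_) (sym ∥T∥≡∥V∥) (max FT′ T′⊆M))
                       smaller V⊆M T⊆M FV FT z∉M w∈V
                       (λ w∈T → proj₁ (∈G⁻ w∈Γ) (⊆-▹ T z w∈T)) (proj₂ (∈G⁻ w∈Γ))

  -- If one set were smaller, the other would augment it by an element of its own; that element
  -- would lie in the common `G`, which is disjoint from both sets.
  rank-unique : ∀ {X Y} → Feas X → Feas Y → G X ≡ G Y → ∥ X ∥ ≡ ∥ Y ∥
  rank-unique FX FY eq = ≤-antisym (le FX FY eq) (le FY FX (sym eq))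
    where
    le : ∀ {X Y} → Feas X → Feas Y → G X ≡ G Y → ∥ X ∥ ≤ ∥ Y ∥
    le {X} {Y} FX FY eq with ≤-<-connex ∥ X ∥ ∥ Y ∥
    ... | inj₁ X≤Y = X≤Y
    ... | inj₂ Y<X with augment FX FY Y<X
    ... | x , x∈X , x∈ΓY = contradiction x∈X (proj₁ (∈G⁻ (subst (x ∈_) (sym eq) x∈ΓY)))

  -- Augment `Y ▹ z` from `X ▹ z ▹ w`. An element of `X` is excluded by `no-detour` with
  -- `M = X ∪ Y`: no feasible set inside `M` is larger than `Y`, because the common `G` meets
  -- neither `X` nor `Y`. So the new element is `w`.
  G-▹-⊆ : ∀ {X Y z} → Feas X → Feas Y → G X ≡ G Y → z ∈ G X → G (X ▹ z) ⊆ G (Y ▹ z)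
  G-▹-⊆ {X} {Y} {z} FX FY eq z∈ΓX {w} w∈Γ = found (augment FXzw FYz Yz<)
    where
    z∈ΓY : z ∈ G Y
    z∈ΓY = subst (z ∈_) eq z∈ΓX

    FXzw : Feas (X ▹ z ▹ w)
    FXzw = proj₂ (∈G⁻ w∈Γ)

    FYz : Feas (Y ▹ z)
    FYz = proj₂ (∈G⁻ z∈ΓY)

    Yz< : ∥ Y ▹ z ∥ < ∥ X ▹ z ▹ w ∥
    Yz< = ≤-reflexive (trans (cong suc (trans (∥▹∥ z∈ΓY)
            (trans (cong suc (sym (rank-unique FX FY eq))) (sym (∥▹∥ z∈ΓX))))) (sym (∥▹∥ w∈Γ)))

    max : ∀ {T} → Feas T → T ⊆ X ∪ Y → ∥ T ∥ ≤ ∥ Y ∥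
    max {T} FT T⊆ with ≤-<-connex ∥ T ∥ ∥ Y ∥
    ... | inj₁ T≤Y = T≤Y
    ... | inj₂ Y<T with augment FT FY Y<T
    ... | t , t∈T , t∈ΓY with x∈p∪q⁻ X Y (T⊆ t∈T)
    ... | inj₁ t∈X = contradiction t∈X (proj₁ (∈G⁻ (subst (t ∈_) (sym eq) t∈ΓY)))
    ... | inj₂ t∈Y = contradiction t∈Y (proj₁ (∈G⁻ t∈ΓY))

    found : ∃[ x ] (x ∈ X ▹ z ▹ w × x ∈ G (Y ▹ z)) → w ∈ G (Y ▹ z)
    found (x , x∈ , x∈Γ) with ∈-▹⁻ (X ▹ z) w x∈
    ... | inj₂ refl = x∈Γ
    ... | inj₁ x∈Xz with ∈-▹⁻ X z x∈Xz
    ... | inj₂ refl = contradiction (∈-▹ Y z) (proj₁ (∈G⁻ x∈Γ))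
    ... | inj₁ x∈X = contradiction (proj₂ (∈G⁻ x∈Γ))
          (no-detour (suc ∥ X ∪ Y ∥) max ≤-refl (p⊆p∪q Y) (q⊆p∪q X Y) FX FY
            ([ proj₁ (∈G⁻ z∈ΓX) , proj₁ (∈G⁻ z∈ΓY) ]′ ∘ x∈p∪q⁻ X Y)
            x∈X (λ x∈Y → proj₁ (∈G⁻ x∈Γ) (⊆-▹ Y z x∈Y)))

  G-▹-cong : ∀ {X Y z} → Feas X → Feas Y → G X ≡ G Y → z ∈ G X → G (X ▹ z) ≡ G (Y ▹ z)
  G-▹-cong {z = z} FX FY eq z∈ = ⊆-antisym (G-▹-⊆ FX FY eq z∈)
    (G-▹-⊆ FY FX (sym eq) (subst (z ∈_) eq z∈))

  -- Here `e` and `x` are parallel over `X`. When `X ▹ e` is augmented from `X ▹ x ▹ w`, the new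
  -- element cannot be `x`, since then `e` would still continue `X ▹ x`.
  G-parallel : ∀ {X x e} → x ∈ G X → e ∈ G X → e ∉ G (X ▹ x) → e ≢ x → G (X ▹ x) ≡ G (X ▹ e)
  G-parallel {X} {x} {e} x∈ e∈ e∉ e≢x = ⊆-antisym (half x∈ e∈ e∉ (e≢x ∘ sym)) (half e∈ x∈ x∉ e≢x)
    where
    x∉ : x ∉ G (X ▹ e)
    x∉ x∈Γ = e∉ (∈G⁺ ([ proj₁ (∈G⁻ e∈) , e≢x ]′ ∘ ∈-▹⁻ X x)
                     (subst Feas (▹-comm X e x) (proj₂ (∈G⁻ x∈Γ))))

    half : ∀ {x e} → x ∈ G X → e ∈ G X → e ∉ G (X ▹ x) → x ≢ e → G (X ▹ x) ⊆ G (X ▹ e)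
    half {x} {e} x∈ e∈ e∉ x≢e {w} w∈
      with augment (proj₂ (∈G⁻ w∈)) (proj₂ (∈G⁻ e∈))
             (≤-reflexive (trans (cong suc (trans (∥▹∥ e∈) (sym (∥▹∥ x∈)))) (sym (∥▹∥ w∈))))
    ... | y , y∈ , y∈Γ with ∈-▹⁻ (X ▹ x) w y∈
    ... | inj₂ refl = y∈Γ
    ... | inj₁ y∈Xx with ∈-▹⁻ X x y∈Xx
    ... | inj₁ y∈X = contradiction (⊆-▹ X e y∈X) (proj₁ (∈G⁻ y∈Γ))
    ... | inj₂ refl = contradiction (∈G⁺ ([ proj₁ (∈G⁻ e∈) , x≢e ∘ sym ]′ ∘ ∈-▹⁻ X x)
                        (subst Feas (▹-comm X e x) (proj₂ (∈G⁻ y∈Γ)))) e∉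

  -- Augmenting repeatedly from `X′` itself fills `X` up to `X′` through feasible sets, so induction
  -- can run downwards from `X′`. The fuel in `go` bounds the number of missing elements.
  chain-induction : ∀ {X′} → Feas X′ → (P : Subset n → Set) → P X′ →
    (∀ {X x} → Feas X → X ▹ x ⊆ X′ → x ∈ G X → P (X ▹ x) → P X) →
    ∀ {X} → Feas X → X ⊆ X′ → P X
  chain-induction {X′} FX′ P base step {X} FX X⊆X′ = go ∥ X′ ∥ FX X⊆X′ (m≤n+m _ _)
    where
    go : ∀ k {X} → Feas X → X ⊆ X′ → ∥ X′ ∥ ≤ ∥ X ∥ + k → P X
    go k {X} FX X⊆X′ le with ≤-<-connex ∥ X′ ∥ ∥ X ∥
    ... | inj₁ X′≤X = subst P (sym (⊆∧≥⇒≡ X⊆X′ X′≤X)) base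
    go zero le₀ X⊆X′ le | inj₂ X<X′ =
      contradiction (<-≤-trans X<X′ (subst (∥ X′ ∥ ≤_) (+-identityʳ _) le)) (n≮n _)
    go (suc k) {X} FX X⊆X′ le | inj₂ X<X′ with augment FX′ FX X<X′
    ... | x , x∈X′ , x∈Γ = step FX (▹-⊆ X⊆X′ x∈X′) x∈Γ (go k (proj₂ (∈G⁻ x∈Γ)) (▹-⊆ X⊆X′ x∈X′)
            (subst (λ j → ∥ X′ ∥ ≤ j + k) (sym (∥▹∥ x∈Γ))
              (subst (∥ X′ ∥ ≤_) (+-suc ∥ X ∥ k) le)))

  -- Opaque because with-abstractions over its results would otherwise normalise its recursion.
  opaque
    transport : ∀ {X X′ Y} → Feas X → Feas X′ → Feas Y → X ⊆ X′ → G X ≡ G Y →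
      ∃[ Y′ ] (Feas Y′ × Y ⊆ Y′ × G X′ ≡ G Y′)
    transport {X} {X′} {Y} FX FX′ FY X⊆X′ eq = chain-induction FX′
      (λ X → ∀ Y → Feas Y → G X ≡ G Y → ∃[ Y′ ] (Feas Y′ × Y ⊆ Y′ × G X′ ≡ G Y′))
      (λ Y FY eq → Y , FY , id , eq) step FX X⊆X′ Y FY eq
      where
      step : ∀ {X x} → Feas X → X ▹ x ⊆ X′ → x ∈ G X →
        (∀ Y → Feas Y → G (X ▹ x) ≡ G Y → ∃[ Y′ ] (Feas Y′ × Y ⊆ Y′ × G X′ ≡ G Y′)) →
        ∀ Y → Feas Y → G X ≡ G Y → ∃[ Y′ ] (Feas Y′ × Y ⊆ Y′ × G X′ ≡ G Y′)
      step {X} {x} FX _ x∈Γ ih Y FY eq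
        with ih (Y ▹ x) (proj₂ (∈G⁻ (subst (x ∈_) eq x∈Γ))) (G-▹-cong FX FY eq x∈Γ)
      ... | Y′ , FY′ , Yx⊆Y′ , eq′ = Y′ , FY′ , ⊆-trans (⊆-▹ Y x) Yx⊆Y′ , eq′

  -- The order on flats

  infix 4 _≼_ _inξ_

  Flat : Subset n → Set
  Flat A = ∃[ X ] (Feas X × G X ≡ A)

  _inξ_ : Fin n → Subset n → Set
  e inξ A = ∃[ X ] (Feas X × G X ≡ A × e ∈ X)

  _≼_ : Subset n → Subset n → Set
  A ≼ B = ∃[ Y ] (Feas Y × G Y ≡ B × ∃[ Z ] (Z ⊆ ∁ Y × Feas (Y ∪ Z) × G (Y ∪ Z) ≡ A))

  ≼⇒flatʳ : ∀ {A B} → A ≼ B → Flat B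
  ≼⇒flatʳ (Y , FY , eq , _) = Y , FY , eq

  ⊆⇒≼ : ∀ {X Y} → Feas X → Feas Y → Y ⊆ X → G X ≼ G Y
  ⊆⇒≼ {X} {Y} FX FY Y⊆X = Y , FY , refl , X ∩ ∁ Y , p∩q⊆q X (∁ Y) , subst Feas (sym eq) FX , cong G eq
    where
    X⊆ : X ⊆ Y ∪ (X ∩ ∁ Y)
    X⊆ {x} x∈X with x ∈? Y
    ... | yes x∈Y = p⊆p∪q _ x∈Y
    ... | no  x∉Y = q⊆p∪q Y _ (x∈p∩q⁺ (x∈X , x∉p⇒x∈∁p x∉Y))

    eq : Y ∪ (X ∩ ∁ Y) ≡ X
    eq = ⊆-antisym ([ Y⊆X , p∩q⊆p X (∁ Y) ]′ ∘ x∈p∪q⁻ Y _) X⊆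

  -- The order is defined through some representative of the upper flat; `transport` carries the
  -- extension found there over to the given `Y`.
  ≼⇒⊆ : ∀ {A Y} → Feas Y → A ≼ G Y → ∃[ X ] (Feas X × Y ⊆ X × G X ≡ A)
  ≼⇒⊆ {A} {Y} FY (Y₀ , FY₀ , eq , Z , _ , FYZ , eq′) with transport FY₀ FYZ FY (p⊆p∪q Z) eq
  ... | X , FX , Y⊆X , eqX = X , FX , Y⊆X , trans (sym eqX) eq′

  ≼-refl : ∀ {A} → Flat A → A ≼ A
  ≼-refl (X , FX , refl) = ⊆⇒≼ FX FX id

  ≼-trans : ∀ {A B C} → A ≼ B → B ≼ C → A ≼ C
  ≼-trans A≼B B≼C with ≼⇒flatʳ B≼C
  ... | Z , FZ , refl with ≼⇒⊆ FZ B≼C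
  ... | Y , FY , Z⊆Y , refl with ≼⇒⊆ FY A≼B
  ... | X , FX , Y⊆X , refl = ⊆⇒≼ FX FZ (⊆-trans Z⊆Y Y⊆X)

  ≼-antisym : ∀ {A B} → A ≼ B → B ≼ A → A ≡ B
  ≼-antisym A≼B B≼A with ≼⇒flatʳ A≼B
  ... | Y , FY , refl with ≼⇒⊆ FY A≼B
  ... | X , FX , Y⊆X , refl with ≼⇒⊆ FX B≼A
  ... | Y′ , FY′ , X⊆Y′ , eq = cong G (sym (⊆∧≥⇒≡ Y⊆X
          (≤-trans (p⊆q⇒∣p∣≤∣q∣ X⊆Y′) (≤-reflexive (rank-unique FY′ FY eq)))))

  ξ-disjoint : ∀ {A e} → e ∈ A → ¬ (e inξ A)
  ξ-disjoint e∈A (X , FX , refl , e∈X) = proj₁ (∈G⁻ e∈A) e∈X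

  ξ-antitone : ∀ {A B e} → B ≼ A → e inξ A → e inξ B
  ξ-antitone B≼A (X , FX , refl , e∈X) with ≼⇒⊆ FX B≼A
  ... | Y , FY , X⊆Y , eq = Y , FY , eq , X⊆Y e∈X

  below-▹⇒inξ : ∀ {X e C} → e ∈ G X → C ≼ G (X ▹ e) → e inξ C
  below-▹⇒inξ {X} {e} e∈Γ C≼ = ξ-antitone C≼ (X ▹ e , proj₂ (∈G⁻ e∈Γ) , refl , ∈-▹ X e)

  ▹-≼ : ∀ {X e} → Feas X → e ∈ G X → G (X ▹ e) ≼ G X
  ▹-≼ {X} {e} FX e∈Γ = ⊆⇒≼ (proj₂ (∈G⁻ e∈Γ)) FX (⊆-▹ X e)

  -- Walk from `X` up to a representative of `C`. The element `e` stays in `G` until it is added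
  -- itself or becomes parallel to the element being added, and either event places `C` below
  -- `G (X ▹ e)`.
  ∈-or-below : ∀ {X e C} → Feas X → e ∈ G X → C ≼ G X → e ∈ C ⊎ C ≼ G (X ▹ e)
  ∈-or-below {X} {e} FX e∈Γ C≼ with ≼⇒⊆ FX C≼
  ... | X′ , FX′ , X⊆X′ , refl = chain-induction FX′
          (λ X → e ∈ G X → e ∈ G X′ ⊎ G X′ ≼ G (X ▹ e)) inj₁ step FX X⊆X′ e∈Γ
    where
    step : ∀ {X x} → Feas X → X ▹ x ⊆ X′ → x ∈ G X →
      (e ∈ G (X ▹ x) → e ∈ G X′ ⊎ G X′ ≼ G (X ▹ x ▹ e)) →
      e ∈ G X → e ∈ G X′ ⊎ G X′ ≼ G (X ▹ e)
    step {X} {x} FX Xx⊆X′ x∈ ih e∈ with e Fin.≟ x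
    ... | yes refl = inj₂ (⊆⇒≼ FX′ (proj₂ (∈G⁻ e∈)) Xx⊆X′)
    ... | no e≢x with e ∈? G (X ▹ x)
    ... | no e∉ = inj₂ (subst (G X′ ≼_) (G-parallel x∈ e∈ e∉ e≢x) (⊆⇒≼ FX′ (proj₂ (∈G⁻ x∈)) Xx⊆X′))
    ... | yes e∈Xx with ih e∈Xx
    ... | inj₁ e∈X′ = inj₁ e∈X′
    ... | inj₂ X′≼ = inj₂ (≼-trans X′≼ (⊆⇒≼ (proj₂ (∈G⁻ e∈Xx)) (proj₂ (∈G⁻ e∈))
                       (▹-⊆ (⊆-trans (⊆-▹ X x) (⊆-▹ (X ▹ x) e)) (∈-▹ (X ▹ x) e))))

  ∈-or-inξ : ∀ {A C e} → C ≼ A → e ∈ A → e ∈ C ⊎ e inξ C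
  ∈-or-inξ C≼A e∈A with ≼⇒flatʳ C≼A
  ... | X , FX , refl with ∈-or-below FX e∈A C≼A
  ... | inj₁ e∈C = inj₁ e∈C
  ... | inj₂ C≼ = inj₂ (below-▹⇒inξ e∈A C≼)

  ∈-convex : ∀ {A B C e} → C ≼ B → B ≼ A → e ∈ A → e ∈ C → e ∈ B
  ∈-convex C≼B B≼A e∈A e∈C with ∈-or-inξ B≼A e∈A
  ... | inj₁ e∈B = e∈B
  ... | inj₂ e∈ξB = contradiction (ξ-antitone C≼B e∈ξB) (ξ-disjoint e∈C)

  -- An element of `T` augmenting `Y` would belong to both ξ and Γ of the same flat.
  ξ-rank : ∀ {Y T} → Feas Y → Feas T → (∀ {x} → x ∈ T → x inξ G Y) → ∥ T ∥ ≤ ∥ Y ∥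
  ξ-rank {Y} {T} FY FT T⊆ξ with ≤-<-connex ∥ T ∥ ∥ Y ∥
  ... | inj₁ T≤Y = T≤Y
  ... | inj₂ Y<T with augment FT FY Y<T
  ... | t , t∈T , t∈Γ = contradiction (T⊆ξ t∈T) (ξ-disjoint t∈Γ)

  -- Augment `T` from `Y ▹ w`, and `Y` from `T ▹ w`. An element other than `w` would give a feasible
  -- set inside ξ above the rank bound in the first case, and an element of both ξ and Γ in the
  -- second.
  ξ-spanning : ∀ {Y T} → Feas Y → Feas T → (∀ {x} → x ∈ T → x inξ G Y) → ∥ T ∥ ≡ ∥ Y ∥ → G T ≡ G Y
  ξ-spanning {Y} {T} FY FT T⊆ξ eq = ⊆-antisym T⊆Y Y⊆T
    where
    Y⊆T : G Y ⊆ G T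
    Y⊆T {w} w∈ with augment (proj₂ (∈G⁻ w∈)) FT (≤-reflexive (trans (cong suc eq) (sym (∥▹∥ w∈))))
    ... | x , x∈ , x∈Γ with ∈-▹⁻ Y w x∈
    ... | inj₂ refl = x∈Γ
    ... | inj₁ x∈Y = contradiction (≤-trans (≤-reflexive (trans (cong suc (sym eq)) (sym (∥▹∥ x∈Γ))))
                       (ξ-rank FY (proj₂ (∈G⁻ x∈Γ)) Tx⊆ξ)) (n≮n _)
      where
      Tx⊆ξ : ∀ {y} → y ∈ T ▹ x → y inξ G Y
      Tx⊆ξ y∈ with ∈-▹⁻ T x y∈
      ... | inj₁ y∈T = T⊆ξ y∈T
      ... | inj₂ refl = Y , FY , refl , x∈Y

    T⊆Y : G T ⊆ G Y
    T⊆Y {w} w∈ with augment (proj₂ (∈G⁻ w∈)) FY (≤-reflexive (trans (cong suc (sym eq)) (sym (∥▹∥ w∈))))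
    ... | x , x∈ , x∈Γ with ∈-▹⁻ T w x∈
    ... | inj₂ refl = x∈Γ
    ... | inj₁ x∈T = contradiction (T⊆ξ x∈T) (ξ-disjoint x∈Γ)

  -- Completing `X` by elements of a representative of `C` stays inside ξ(C), where full rank
  -- already determines the flat.
  ⊆ξ⇒≼ : ∀ {C X} → Flat C → Feas X → (∀ {x} → x ∈ X → x inξ C) → C ≼ G X
  ⊆ξ⇒≼ {X = X} (Y , FY , refl) FX X⊆ξ with extend FX FY (ξ-rank FY FX X⊆ξ)
  ... | T , FT , X⊆T , T⊆XY , eq = subst (_≼ G X) (ξ-spanning FY FT T⊆ξ eq) (⊆⇒≼ FT FX X⊆T)
    where
    T⊆ξ : ∀ {x} → x ∈ T → x inξ G Y
    T⊆ξ x∈T with x∈p∪q⁻ X Y (T⊆XY x∈T)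
    ... | inj₁ x∈X = X⊆ξ x∈X
    ... | inj₂ x∈Y = Y , FY , refl , x∈Y

  flat? : Decidable Flat
  flat? A = anySubset? λ X → Feas? X ×-dec ≡-dec Bool._≟_ (G X) A

  _≼?_ : ∀ A B → Dec (A ≼ B)
  A ≼? B = anySubset? λ Y → Feas? Y ×-dec ≡-dec Bool._≟_ (G Y) B ×-dec
    anySubset? λ Z → (Z ⊆? ∁ Y) ×-dec Feas? (Y ∪ Z) ×-dec ≡-dec Bool._≟_ (G (Y ∪ Z)) A

  -- If `C` were strictly lower, some element added on the way from `X` to `X′` would lie in `A` but
  -- not in `C`. For S listing Γ(A), this collapses `N` to its single term at `A`.
  ≼∧⊇⇒≡ : ∀ {A C} → C ≼ A → A ⊆ C → C ≡ A
  ≼∧⊇⇒≡ C≼A A⊆C with ≼⇒flatʳ C≼A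
  ... | X , FX , refl with ≼⇒⊆ FX C≼A
  ... | X′ , FX′ , X⊆X′ , refl with ≤-<-connex ∥ X′ ∥ ∥ X ∥
  ... | inj₁ X′≤X = cong G (sym (⊆∧≥⇒≡ X⊆X′ X′≤X))
  ... | inj₂ X<X′ with augment FX′ FX X<X′
  ... | x , x∈X′ , x∈G = contradiction x∈X′ (proj₁ (∈G⁻ (A⊆C x∈G)))

  -- For comparable flats the join is the larger one: ξ of the larger flat is contained in ξ of the
  -- smaller, and `X` already has the largest feasible size in it. The conclusion is `MaxFeasibleIn`
  -- unfolded.
  basis-maximal : ∀ {B X} → Feas X → B ≼ G X →
    Feas X × (∀ e → e ∈ X → e inξ B × e inξ G X) ×
    (∀ Y → Feas Y → X ⊆ Y → (∀ e → e ∈ Y → e inξ B × e inξ G X) → Y ≡ X)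
  basis-maximal {X = X} FX B≼ = FX ,
    (λ e e∈X → let e∈ξ = X , FX , refl , e∈X in ξ-antitone B≼ e∈ξ , e∈ξ) ,
    λ Y FY X⊆Y Y⊆ξ → sym (⊆∧≥⇒≡ X⊆Y (ξ-rank FX FY (λ y∈ → proj₂ (Y⊆ξ _ y∈))))

  bottom⇒∉ : ∀ {A e} → Flat A → (∀ B → Flat B → A ≼ B) → e ∉ A
  bottom⇒∉ {e = e} (X , FX , refl) least e∈ =
    ξ-disjoint e∈ (below-▹⇒inξ e∈ (least (G (X ▹ e)) (X ▹ e , proj₂ (∈G⁻ e∈) , refl)))

  -- Rank and contraction by one element

  HasRank : Subset n → ℕ → Set
  HasRank A r = ∃[ X ] (Feas X × G X ≡ A × ∥ X ∥ ≡ r)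

  flat⇒rank : ∀ {A} → Flat A → ∃ (HasRank A)
  flat⇒rank (X , FX , eq) = ∥ X ∥ , X , FX , eq , refl

  HasRank-unique : ∀ {A r s} → HasRank A r → HasRank A s → r ≡ s
  HasRank-unique (X , FX , eq , refl) (Y , FY , eq′ , refl) = rank-unique FX FY (trans eq (sym eq′))

  -- For A = [X] the flat A′ is [X ∪ {e}], described here without choosing X.
  record Contraction (A : Subset n) (e : Fin n) (A′ : Subset n) : Set where
    field
      flat      : Flat A′
      below     : A′ ≼ A
      e-inξ     : e inξ A′
      dichotomy : ∀ {C} → C ≼ A → e ∈ C ⊎ C ≼ A′
      greatest  : ∀ {C} → Flat C → (∀ {x} → x inξ A → x inξ C) → e inξ C → C ≼ A′
      rank-suc  : ∀ {r} → HasRank A r → HasRank A′ (suc r)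

  contract : ∀ {A e} → Flat A → e ∈ A → ∃ (Contraction A e)
  contract {e = e} (X , FX , refl) e∈G = G (X ▹ e) , record
    { flat      = X ▹ e , FXe , refl
    ; below     = ▹-≼ FX e∈G
    ; e-inξ     = X ▹ e , FXe , refl , ∈-▹ X e
    ; dichotomy = ∈-or-below FX e∈G
    ; greatest  = λ flatC ξA⊆ξC e∈ξC → ⊆ξ⇒≼ flatC FXe λ x∈ →
        [ (λ x∈X → ξA⊆ξC (X , FX , refl , x∈X)) , (λ { refl → e∈ξC }) ]′ (∈-▹⁻ X e x∈)
    ; rank-suc  = λ rank → X ▹ e , FXe , refl ,
        trans (∥▹∥ e∈G) (cong suc (HasRank-unique (X , FX , refl , refl) rank))
    }
    where
    FXe : Feas (X ▹ e)
    FXe = proj₂ (∈G⁻ e∈G)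

  -- For a covector with support `A` these are the coordinates whose value is not `𝟏`. Unlike Γ(A),
  -- the set only grows when `A` descends, so it can serve as the invariant for S.
  Visible : Subset n → Fin n → Set
  Visible A e = e ∈ A ⊎ e inξ A

  visible-≼ : ∀ {A C e} → C ≼ A → Visible A e → Visible C e
  visible-≼ C≼A (inj₁ e∈A) = ∈-or-inξ C≼A e∈A
  visible-≼ C≼A (inj₂ e∈ξ) = inj₂ (ξ-antitone C≼A e∈ξ)

  -- Partial Möbius sums

  module Möbius (m : Subset n → Subset n → ℤ)
    (m-refl : ∀ A → Flat A → m A A ≡ ℤ.1ℤ)
    (m-sum : ∀ B A → Flat B → Flat A → B ≼ A × B ≢ A →
      ∀ l → Enumerates l (λ C → Flat C × B ≼ C × C ≼ A) → sumℤ (map (m B) l) ≡ ℤ.0ℤ)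
    where

    open Finite (Vec-finite Bool-finite n) renaming (elements to subsets)
    open module ∑ℤ = Summation ℤ.+-0-isCommutativeMonoid
      using () renaming (∑ to ∑ℤ; [_]·_ to [_]ℤ·_)

    Between : Subset n → Subset n → List (Fin n) → Subset n → Set
    Between B A S C = (Flat C × B ≼ C × C ≼ A) × All (_∈ C) S

    between? : ∀ B A S → Decidable (Between B A S)
    between? B A S C = (flat? C ×-dec (B ≼? C) ×-dec (C ≼? A)) ×-dec All.all? (_∈? C) S

    -- A partial Möbius sum, interpolating between ∑_{B ≤ C ≤ A} m B C (S empty)
    -- and m B A (S = Γ(A)).
    N : Subset n → Subset n → List (Fin n) → ℤ
    N B A S = ∑ℤ subsets λ C → [ between? B A S C ]ℤ· m B C

    N-empty : ∀ {B A S} → (∀ {C} → ¬ Between B A S C) → N B A S ≡ ℤ.0ℤ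
    N-empty {B} {A} {S} none = ∑ℤ.∑-ε subsets λ C → ∑ℤ.[]·-no (between? B A S C) none

    N-single : ∀ {B A S C} → Between B A S C → (∀ {C′} → Between B A S C′ → C′ ≡ C) → N B A S ≡ m B C
    N-single {B} {A} {S} between unique-C =
      ∑ℤ.∑-single (Vec-finite Bool-finite n) (between? B A S) between unique-C (m B)

    N-[]-≢ : ∀ {B A} → Flat B → Flat A → B ≢ A → N B A [] ≡ ℤ.0ℤ
    N-[]-≢ {B} {A} flatB flatA B≢A with B ≼? A
    ... | no B⋠A = N-empty λ ((_ , B≼C , C≼A) , _) → B⋠A (≼-trans B≼C C≼A)
    ... | yes B≼A = trans (sym (∑ℤ.∑-filter (between? B A []) subsets (m B)))
      (m-sum B A flatB flatA (B≼A , B≢A) (filter (between? B A []) subsets) (proj₁ enum ,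
        λ C → mk⇔ (proj₁ ∘ to (proj₂ enum C)) (λ p → from (proj₂ enum C) (p , []))))
      where
      enum : Enumerates (filter (between? B A []) subsets) (Between B A [])
      enum = Finite.filter-enumerates (Vec-finite Bool-finite n) (between? B A [])

    N-[]-≡ : ∀ {A} → Flat A → N A A [] ≡ ℤ.1ℤ
    N-[]-≡ flatA = trans (N-single ((flatA , ≼-refl flatA , ≼-refl flatA) , [])
      λ ((_ , A≼C , C≼A) , _) → ≼-antisym C≼A A≼C) (m-refl _ flatA)

    N-∷ : ∀ {B A e A′ S} → Contraction A e A′ → N B A S ≡ N B A (e ∷ S) ℤ.+ N B A′ S
    N-∷ {B} {A} {e} {A′} {S} c = trans
      (∑ℤ.∑-cong subsets λ C → ∑ℤ.[]·-⊎ (between? B A S C) (between? B A (e ∷ S) C) (between? B A′ S C)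
        split
        (λ { (i , _ ∷ S⊆C) → i , S⊆C })
        (λ ((flatC , B≼C , C≼A′) , S⊆C) → (flatC , B≼C , ≼-trans C≼A′ below) , S⊆C)
        (λ { (_ , e∈C ∷ _) ((_ , _ , C≼A′) , _) → ξ-disjoint e∈C (ξ-antitone C≼A′ e-inξ) }))
      (∑ℤ.∑-∙ subsets _ _)
      where
      open Contraction c
      split : ∀ {C} → Between B A S C → Between B A (e ∷ S) C ⊎ Between B A′ S C
      split ((flatC , B≼C , C≼A) , S⊆C) with dichotomy C≼A
      ... | inj₁ e∈C = inj₁ ((flatC , B≼C , C≼A) , e∈C ∷ S⊆C)
      ... | inj₂ C≼A′ = inj₂ ((flatC , B≼C , C≼A′) , S⊆C)

    N-hidden : ∀ {B A e S} → e inξ A → N B A (e ∷ S) ≡ ℤ.0ℤ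
    N-hidden e∈ξ = N-empty λ { ((_ , _ , C≼A) , e∈C ∷ _) → ξ-disjoint e∈C (ξ-antitone C≼A e∈ξ) }

    parity : ℕ → Sgn.Sign
    parity zero = Sgn.+
    parity (suc r) = opposite (parity r)

    -- By `N-∷` the value at `e ∷ S` is a difference, and its two terms have opposite signs because
    -- `A′` has rank one higher. A zero value fits either sign, with `p = 0`. For S listing Γ(A)
    -- this is the alternation of the sign of the Möbius function.
    N-sign : ∀ {B s} → Flat B → HasRank B s → ∀ S {A r} → Flat A → HasRank A r → All (Visible A) S →
      ∃[ p ] (N B A S ≡ (parity r Sgn.* parity s) ℤ.◃ p)
    N-sign {B} flatB rankB [] {A} {r} flatA rankA [] with ≡-dec Bool._≟_ B A
    ... | no B≢A = 0 , N-[]-≢ flatB flatA B≢A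
    ... | yes refl with HasRank-unique rankB rankA
    ... | refl = 1 , trans (N-[]-≡ flatA) (cong (ℤ._◃ 1) (sym (Sgn.s*s≡+ (parity r))))
    N-sign flatB rankB (e ∷ S) flatA rankA (inj₂ e∈ξ ∷ vis) = 0 , N-hidden e∈ξ
    N-sign {B} {s} flatB rankB (e ∷ S) {A} {r} flatA rankA (inj₁ e∈A ∷ vis) with contract flatA e∈A
    ... | A′ , c with N-sign flatB rankB S flatA rankA vis
                    | N-sign flatB rankB S (Contraction.flat c) (Contraction.rank-suc c rankA)
                        (All.map (visible-≼ (Contraction.below c)) vis)
    ... | p , eq | q , eq′ = p + q , ◃-cancel {x = N B A (e ∷ S)} p q (trans (sym (N-∷ {S = S} c)) eq) (trans eq′ (cong (ℤ._◃ q) (opposite-*ˡ (parity r) _)))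

    ∣N-∷∣ : ∀ {B A e A′ S} → Flat B → Flat A → Contraction A e A′ → All (Visible A) S →
      ∣ N B A (e ∷ S) ∣ ≡ ∣ N B A S ∣ + ∣ N B A′ S ∣
    ∣N-∷∣ {B} {A} {e} {A′} {S} flatB flatA c vis
      with flat⇒rank flatB | flat⇒rank flatA
    ... | s , rankB | r , rankA
      with N-sign flatB rankB S flatA rankA vis
         | N-sign flatB rankB S (Contraction.flat c) (Contraction.rank-suc c rankA)
             (All.map (visible-≼ (Contraction.below c)) vis)
    ... | p , eq | q , eq′ = begin
      ∣ N B A (e ∷ S) ∣          ≡⟨ cong ∣_∣ (◃-cancel {x = N B A (e ∷ S)} p q (trans (sym (N-∷ {S = S} c)) eq) (trans eq′ (cong (ℤ._◃ q) (opposite-*ˡ (parity r) _)))) ⟩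
      ∣ _ ℤ.◃ (p + q) ∣          ≡⟨ ℤ.abs-◃ _ (p + q) ⟩
      p + q                      ≡⟨ sym (cong₂ _+_ (trans (cong ∣_∣ eq) (ℤ.abs-◃ _ p)) (trans (cong ∣_∣ eq′) (ℤ.abs-◃ _ q))) ⟩
      ∣ N B A S ∣ + ∣ N B A′ S ∣ ∎
      where open ≡-Reasoning

    -- The range of `B` does not depend on `A`, so the recursion for `N` can be applied term by
    -- term. A `B` not below `A` contributes 0, its `N` being an empty sum.
    P : Subset n → Subset n → List (Fin n) → ℕ
    P D A S = ∑ subsets λ B → [ D ≼? B ]· ∣ N B A S ∣

    -- For empty S the sum `N` is the full Möbius sum over an interval, which vanishes unless `B` is
    -- `A`.
    P-[]-≼ : ∀ {D A} → D ≼ A → P D A [] ≡ 1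
    P-[]-≼ {D} {A} D≼A = trans (∑-cong subsets indicator)
      (∑-single (Vec-finite Bool-finite n) (λ B → ≡-dec Bool._≟_ B A) refl id (λ _ → 1))
      where
      indicator : ∀ B → [ D ≼? B ]· ∣ N B A [] ∣ ≡ [ ≡-dec Bool._≟_ B A ]· 1
      indicator B with ≡-dec Bool._≟_ B A
      ... | yes refl = trans ([]·-yes (D ≼? A) D≼A) (cong ∣_∣ (N-[]-≡ (≼⇒flatʳ D≼A)))
      ... | no B≢A with D ≼? B
      ... | yes D≼B = cong ∣_∣ (N-[]-≢ (≼⇒flatʳ D≼B) (≼⇒flatʳ D≼A) B≢A)
      ... | no _ = refl

    P-empty : ∀ {D A S} → (∀ {B C} → D ≼ B → ¬ Between B A S C) → P D A S ≡ 0
    P-empty {D} {A} {S} none = ∑-ε subsets vanish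
      where
      vanish : ∀ B → [ D ≼? B ]· ∣ N B A S ∣ ≡ 0
      vanish B with D ≼? B
      ... | yes D≼B = cong ∣_∣ (N-empty {S = S} (none D≼B))
      ... | no _ = refl

    P-∷ : ∀ {D A e A′ S} → Flat A → Contraction A e A′ → All (Visible A) S →
      P D A (e ∷ S) ≡ P D A S + P D A′ S
    P-∷ {D} {A} {e} {A′} {S} flatA c vis = trans (∑-cong subsets split) (∑-∙ subsets _ _)
      where
      split : ∀ B → [ D ≼? B ]· ∣ N B A (e ∷ S) ∣ ≡ [ D ≼? B ]· ∣ N B A S ∣ + [ D ≼? B ]· ∣ N B A′ S ∣
      split B with D ≼? B
      ... | yes D≼B = ∣N-∷∣ {S = S} (≼⇒flatʳ D≼B) flatA c vis
      ... | no _ = refl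

    P-full : ∀ {D A S reps} → Flat A → All (_∈ A) S → (∀ {e} → e ∈ A → e ∈ₗ S) →
      Enumerates reps (λ C → Flat C × D ≼ C × C ≼ A) → P D A S ≡ sum (map (λ B → ∣ m B A ∣) reps)
    P-full {D} {A} {S} flatA S⊆A A⊆S enum = sym (trans
      (∑-enumerates (Vec-finite Bool-finite n) (λ C → flat? C ×-dec (D ≼? C) ×-dec (C ≼? A)) enum _)
      (∑-cong subsets restrict))
      where
      restrict : ∀ B → [ flat? B ×-dec (D ≼? B) ×-dec (B ≼? A) ]· ∣ m B A ∣ ≡ [ D ≼? B ]· ∣ N B A S ∣
      restrict B with D ≼? B
      ... | no D⋠B = []·-no (flat? B ×-dec (no D⋠B) ×-dec (B ≼? A)) (D⋠B ∘ proj₁ ∘ proj₂)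
      ... | yes D≼B with B ≼? A
      ... | no B⋠A = trans ([]·-no (flat? B ×-dec yes D≼B ×-dec no B⋠A) (B⋠A ∘ proj₂ ∘ proj₂))
              (sym (cong ∣_∣ (N-empty {S = S} λ ((_ , B≼C , C≼A) , _) → B⋠A (≼-trans B≼C C≼A))))
      ... | yes B≼A = trans ([]·-yes (flat? B ×-dec yes D≼B ×-dec yes B≼A) (≼⇒flatʳ D≼B , D≼B , B≼A))
              (sym (cong ∣_∣ (N-single {S = S} ((flatA , B≼A , ≼-refl flatA) , S⊆A)
                λ ((_ , _ , C≼A) , S⊆C) → ≼∧⊇⇒≡ C≼A λ e∈A → All.lookup S⊆C (A⊆S e∈A))))

  -- Covectors with a given support

  module Covectors (𝓛 : Covec n → Set) (𝓛? : Decidable 𝓛)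
    (supp-flat : ∀ {α} → 𝓛 α → Flat (supp α))
    (zero⇔ : ∀ {α} → 𝓛 α → ∀ e → lookup α e ≡ 𝟎 ⇔ e inξ supp α)
    (supp-onto : ∀ A → Flat A → ∃[ α ] (𝓛 α × supp α ≡ A))
    (negate : ∀ α → 𝓛 α → 𝓛 (neg α))
    (compose : ∀ {α β} → 𝓛 α → 𝓛 β → supp α ≼ supp β →
      ∃[ γ ] (𝓛 γ × supp γ ≡ supp β × ∀ e → lookup γ e ≡ pick (lookup α e) (lookup β e)))
    (eliminate : ∀ {α β e} → 𝓛 α → 𝓛 β → supp α ≡ supp β → Sep α β e →
      ∃[ γ ] (𝓛 γ × lookup γ e ≡ 𝟎 × ∀ f → ¬ Sep α β f → lookup α f ≢ 𝟏 → lookup γ f ≡ lookup α f))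
    where

    open Finite (Vec-finite Sign-finite n) using () renaming (elements to covecs)

    sign-at : ∀ {A e} → Flat A → e ∈ A → ∀ b → ∃[ α ] (𝓛 α × supp α ≡ A × lookup α e ≡ sign b)
    sign-at {e = e} flatA e∈A b with supp-onto _ flatA
    ... | α , α∈𝓛 , refl with supp⇒sign α e∈A
    ... | c , eq with c Bool.≟ b
    ... | yes refl = α , α∈𝓛 , refl , eq
    ... | no c≢b = neg α , negate α α∈𝓛 , supp-neg α ,
      trans (lookup-map e negS α) (trans (cong negS eq) (negS-sign c≢b))

    -- On ξ(A) both covectors are zero and hence not separated, so the eliminated `γ` vanishes there
    -- as well as at `e`; `greatest` then bounds its support by `A′`. The support may be strictly
    -- lower.
    eliminate-into : ∀ {A e A′ α β} → Contraction A e A′ → 𝓛 α → 𝓛 β → supp α ≡ A → supp β ≡ A →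
      lookup α e ≡ ⊕ → lookup β e ≡ ⊖ →
      ∃[ γ ] (𝓛 γ × supp γ ≼ A′ ×
              ∀ f b → lookup α f ≡ sign b → lookup β f ≡ sign b → lookup γ f ≡ sign b)
    eliminate-into {e = e} {α = α} {β} c α∈𝓛 β∈𝓛 refl suppβ αe βe
      with eliminate α∈𝓛 β∈𝓛 (sym suppβ) (inj₁ (αe , βe))
    ... | γ , γ∈𝓛 , γe , γ≡α = γ , γ∈𝓛 , greatest (supp-flat γ∈𝓛) ξ⊆ (to (zero⇔ γ∈𝓛 e) γe) , common
      where
      open Contraction c
      ξ⊆ : ∀ {x} → x inξ supp α → x inξ supp γ
      ξ⊆ {x} x∈ξ = to (zero⇔ γ∈𝓛 x) (trans (γ≡α x ¬sep (subst (_≢ 𝟏) (sym αx≡𝟎) λ ())) αx≡𝟎)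
        where
        αx≡𝟎 : lookup α x ≡ 𝟎
        αx≡𝟎 = from (zero⇔ α∈𝓛 x) x∈ξ

        ¬sep : ¬ Sep α β x
        ¬sep (inj₁ (αx , _)) = contradiction (trans (sym αx≡𝟎) αx) λ ()
        ¬sep (inj₂ (αx , _)) = contradiction (trans (sym αx≡𝟎) αx) λ ()

      common : ∀ f b → lookup α f ≡ sign b → lookup β f ≡ sign b → lookup γ f ≡ sign b
      common f b αf βf = trans (γ≡α f ¬sep (subst (_≢ 𝟏) (sym αf) (sign≢𝟏 b))) αf
        where
        sign≢𝟏 : ∀ b → sign b ≢ 𝟏
        sign≢𝟏 true  ()
        sign≢𝟏 false ()

        ¬sep : ¬ Sep α β f
        ¬sep (inj₁ (α⊕ , β⊖)) = contradiction (trans (trans (sym α⊕) αf) (trans (sym βf) β⊖)) λ ()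
        ¬sep (inj₂ (α⊖ , β⊕)) = contradiction (trans (trans (sym α⊖) αf) (trans (sym βf) β⊕)) λ ()

    -- The support fixes where a covector is `𝟎`, namely on its ξ, and hence where it is `𝟏`; only
    -- the signs remain free.
    covector-unique : ∀ {α β} → 𝓛 α → 𝓛 β → supp α ≡ supp β →
      (∀ {e} → e ∈ supp α → lookup α e ≡ lookup β e) → α ≡ β
    covector-unique {α} {β} α∈𝓛 β∈𝓛 eq agree = lookup-injective same
      where
      same : ∀ e → lookup α e ≡ lookup β e
      same e with e ∈? supp α
      ... | yes e∈ = agree e∈
      ... | no e∉ with lookup α e ≟ˢ 𝟎
      ... | yes αe≡𝟎 = trans αe≡𝟎 (sym (from (zero⇔ β∈𝓛 e) (subst (e inξ_) eq (to (zero⇔ α∈𝓛 e) αe≡𝟎))))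
      ... | no αe≢𝟎 = trans (neither⇒𝟏 α e∉ αe≢𝟎) (sym (neither⇒𝟏 β (e∉ ∘ subst (e ∈_) (sym eq))
              λ βe≡𝟎 → αe≢𝟎 (from (zero⇔ α∈𝓛 e) (subst (e inξ_) (sym eq) (to (zero⇔ β∈𝓛 e) βe≡𝟎)))))

    patterns : List (Fin n) → List (List (Fin n × Bool))
    patterns [] = [] ∷ []
    patterns (e ∷ S) = map ((e , true) ∷_) (patterns S) ++ map ((e , false) ∷_) (patterns S)

    patterns-keys : ∀ S {p} → p ∈ₗ patterns S → map proj₁ p ≡ S
    patterns-keys [] (here refl) = refl
    patterns-keys (e ∷ S) p∈ with ∈-++⁻ (map ((e , true) ∷_) (patterns S)) p∈
    ... | inj₁ p∈₁ with ∈-map⁻ ((e , true) ∷_) p∈₁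
    ...   | _ , q∈ , refl = cong (e ∷_) (patterns-keys S q∈)
    patterns-keys (e ∷ S) p∈ | inj₂ p∈₂ with ∈-map⁻ ((e , false) ∷_) p∈₂
    ...   | _ , q∈ , refl = cong (e ∷_) (patterns-keys S q∈)

    ∑-patterns : ∀ e S (f : List (Fin n × Bool) → ℕ) →
      ∑ (patterns (e ∷ S)) f ≡ ∑ (patterns S) λ p → f ((e , true) ∷ p) + f ((e , false) ∷ p)
    ∑-patterns e S f = trans (∑-++ (map ((e , true) ∷_) (patterns S)) _ f)
      (trans (cong₂ _+_ (∑-map _ (patterns S) f) (∑-map _ (patterns S) f)) (sym (∑-∙ (patterns S) _ _)))

    -- Covectors above a fixed covector, and their sign patterns

    module Above {δ : Covec n} (δ∈𝓛 : 𝓛 δ) where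

      -- The last component is `δ ≤ᶜ α` unfolded.
      Cell : Subset n → Covec n → Set
      Cell A α = 𝓛 α × supp α ≡ A ×
        (supp δ ≼ supp α × (∀ e → e ∈ supp δ → e ∈ supp α → lookup δ e ≡ lookup α e))

      cell? : ∀ A → Decidable (Cell A)
      cell? A α = 𝓛? α ×-dec ≡-dec Bool._≟_ (supp α) A ×-dec (supp δ ≼? supp α) ×-dec
        Fin.all? λ e → (e ∈? supp δ) →-dec (e ∈? supp α) →-dec (lookup δ e ≟ˢ lookup α e)

      Realised : Subset n → List (Fin n × Bool) → Set
      Realised A p = ∃[ α ] (Cell A α × Matches α p)

      matching? : ∀ A p → Decidable (λ α → Cell A α × Matches α p)
      matching? A p α = cell? A α ×-dec All.all? (λ (e , b) → lookup α e ≟ˢ sign b) p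

      realised? : ∀ A p → Dec (Realised A p)
      realised? A p = Finite.exists? (Vec-finite Sign-finite n) (matching? A p)

      -- `γ` vanishes at `e`, so `γ ∘ α` takes there whichever sign was chosen for `α`, while on the
      -- coordinates of `p` the signs of `γ` prevail.
      raise : ∀ {A e A′ p} → Flat A → e ∈ A → Contraction A e A′ → All (Visible A ∘ proj₁) p →
        Realised A′ p → ∀ b → Realised A ((e , b) ∷ p)
      raise {A} {e} {A′} {p} flatA e∈A c vis (γ , (γ∈𝓛 , refl , D≼A′ , δ≡γ) , matches) b
        with sign-at flatA e∈A b
      ... | α , α∈𝓛 , refl , αe with compose γ∈𝓛 α∈𝓛 (Contraction.below c)
      ... | π , π∈𝓛 , suppπ , π≡ = π , (π∈𝓛 , suppπ , subst (supp δ ≼_) (sym suppπ) (≼-trans D≼A′ below) , agree) ,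
        trans (π≡ e) (trans (cong (λ s → pick s (lookup α e)) (from (zero⇔ γ∈𝓛 e) e-inξ)) αe) ∷
        All.zipWith keep (vis , matches)
        where
        open Contraction c
        π≡γ : ∀ {f} → f ∈ supp γ → f ∈ supp α → lookup π f ≡ lookup γ f
        π≡γ f∈γ f∈α = trans (π≡ _) (pick-supp γ α f∈γ f∈α)

        agree : ∀ f → f ∈ supp δ → f ∈ supp π → lookup δ f ≡ lookup π f
        agree f f∈δ f∈π = trans (δ≡γ f f∈δ f∈γ) (sym (π≡γ f∈γ f∈α))
          where
          f∈α = subst (f ∈_) suppπ f∈π
          f∈γ = ∈-convex D≼A′ below f∈α f∈δ

        keep : ∀ {q} → Visible A (proj₁ q) × lookup γ (proj₁ q) ≡ sign (proj₂ q) → lookup π (proj₁ q) ≡ sign (proj₂ q)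
        keep {q} (inj₁ f∈α , eq) = trans (π≡γ (sign⇒supp γ (proj₂ q) eq) f∈α) eq
        keep {q} (inj₂ f∈ξ , eq) = contradiction (ξ-antitone below f∈ξ) (ξ-disjoint (sign⇒supp γ (proj₂ q) eq))

      -- Elimination at `e` keeps the signs common to `α` and `β`, but its result can have support
      -- strictly below `A′` and need not lie above `δ`. Composing with some `ε` of support `A′` on
      -- the right repairs the support, and composing with `δ` on the left puts the result above
      -- `δ`.
      lower : ∀ {A e A′ p} → Contraction A e A′ →
        Realised A ((e , true) ∷ p) → Realised A ((e , false) ∷ p) → Realised A′ p
      lower {A} {e} {A′} {p} c
        (α , (α∈𝓛 , refl , D≼A , δ≡α) , αe ∷ matchesα) (β , (β∈𝓛 , suppβ , _ , δ≡β) , βe ∷ matchesβ)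
        with eliminate-into c α∈𝓛 β∈𝓛 refl suppβ αe βe | supp-onto A′ (Contraction.flat c)
      ... | γ , γ∈𝓛 , γ≼A′ , common | ε , ε∈𝓛 , refl with compose γ∈𝓛 ε∈𝓛 γ≼A′ | Contraction.dichotomy c D≼A
      -- If `e` were in the support of `δ`, then `α` and `β` would both have to agree with `δ` at
      -- `e`, where they have opposite signs.
      ... | _ | inj₁ e∈δ = contradiction
        (trans (sym αe) (trans (sym (δ≡α e e∈δ (sign⇒supp α true αe)))
                               (trans (δ≡β e e∈δ (sign⇒supp β false βe)) βe))) λ ()
      ... | κ , κ∈𝓛 , suppκ , κ≡ | inj₂ D≼A′ with compose δ∈𝓛 κ∈𝓛 (subst (supp δ ≼_) (sym suppκ) D≼A′)
      ... | π , π∈𝓛 , suppπ , π≡ =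
        π , (π∈𝓛 , trans suppπ suppκ , subst (supp δ ≼_) (sym (trans suppπ suppκ)) D≼A′ , agree) ,
        All.zipWith keep (matchesα , matchesβ)
        where
        agree : ∀ f → f ∈ supp δ → f ∈ supp π → lookup δ f ≡ lookup π f
        agree f f∈δ f∈π = sym (trans (π≡ f) (pick-supp δ κ f∈δ (subst (f ∈_) suppπ f∈π)))

        keep : ∀ {q} → lookup α (proj₁ q) ≡ sign (proj₂ q) × lookup β (proj₁ q) ≡ sign (proj₂ q) →
          lookup π (proj₁ q) ≡ sign (proj₂ q)
        keep {f , b} (αf , βf) = trans (π≡ f) (trans (cong (pick (lookup δ f)) κf) δκf)
          where
          f∈α : f ∈ supp α
          f∈α = sign⇒supp α b αf

          γf : lookup γ f ≡ sign b
          γf = common f b αf βf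

          f∈A′ : f ∈ supp ε
          f∈A′ with ∈-or-inξ (Contraction.below c) f∈α
          ... | inj₁ f∈ = f∈
          ... | inj₂ f∈ξ = contradiction (ξ-antitone γ≼A′ f∈ξ) (ξ-disjoint (sign⇒supp γ b γf))

          κf : lookup κ f ≡ sign b
          κf = trans (κ≡ f) (trans (pick-supp γ ε (sign⇒supp γ b γf) f∈A′) γf)

          -- The left factor `δ` does no harm on the pattern: at `f` it either has the sign of `α`
          -- or is zero.
          δκf : pick (lookup δ f) (sign b) ≡ sign b
          δκf with ∈-or-inξ D≼A f∈α
          ... | inj₁ f∈δ = trans (cong (λ s → pick s (sign b)) (trans (δ≡α f f∈δ f∈α) αf)) (pick-sign b b)
          ... | inj₂ f∈ξ = cong (λ s → pick s (sign b)) (from (zero⇔ δ∈𝓛 f) f∈ξ)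

      realised-[] : ∀ {A} → supp δ ≼ A → Realised A []
      realised-[] {A} D≼A with supp-onto A (≼⇒flatʳ D≼A)
      ... | α , α∈𝓛 , refl with compose δ∈𝓛 α∈𝓛 D≼A
      ... | π , π∈𝓛 , suppπ , π≡ = π , (π∈𝓛 , suppπ , subst (supp δ ≼_) (sym suppπ) D≼A ,
        λ f f∈δ f∈π → sym (trans (π≡ f) (pick-supp δ α f∈δ (subst (f ∈_) suppπ f∈π)))) , []

      realised⇒≼ : ∀ {A p} → Realised A p → supp δ ≼ A
      realised⇒≼ (_ , (_ , refl , D≼A , _) , _) = D≼A

      T : Subset n → List (Fin n) → ℕ
      T A S = ∑ (patterns S) λ p → [ realised? A p ]· 1

      T-[]-≼ : ∀ {A} → supp δ ≼ A → T A [] ≡ 1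
      T-[]-≼ {A} D≼A = cong (_+ 0) ([]·-yes (realised? A []) (realised-[] D≼A))

      T-[]-⋠ : ∀ {A} → ¬ supp δ ≼ A → T A [] ≡ 0
      T-[]-⋠ {A} D⋠A = cong (_+ 0) ([]·-no (realised? A []) (D⋠A ∘ realised⇒≼))

      T-hidden : ∀ {A e} S → e inξ A → T A (e ∷ S) ≡ 0
      T-hidden {A} {e} S e∈ξ = trans (∑-patterns e S _) (∑-ε (patterns S) λ p →
          cong₂ _+_ ([]·-no (realised? A ((e , true) ∷ p)) none) ([]·-no (realised? A ((e , false) ∷ p)) none))
        where
        none : ∀ {b p} → ¬ Realised A ((e , b) ∷ p)
        none {b} (α , (_ , refl , _) , αe ∷ _) = ξ-disjoint (sign⇒supp α b αe) e∈ξ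

      T-∷ : ∀ {A e A′} S → Flat A → e ∈ A → Contraction A e A′ → All (Visible A) S →
        T A (e ∷ S) ≡ T A S + T A′ S
      T-∷ {A} {e} {A′} S flatA e∈A c vis = trans (∑-patterns e S _)
        (trans (∑-cong-∈ (patterns S) λ {p} p∈ →
                 -- For each `p`, at least one extension is realised exactly when `p` is realised
                 -- over `A`, and both are exactly when `p` is realised over `A′`.
                 []·-exchange (realised? A ((e , true) ∷ p)) (realised? A ((e , false) ∷ p)) (realised? A p) (realised? A′ p)
                   forget forget choose (lower c)
                   λ r → let up = raise flatA e∈A c (visible-keys p∈) r in up true , up false)
               (∑-∙ (patterns S) _ _))
        where
        forget : ∀ {b p} → Realised A ((e , b) ∷ p) → Realised A p
        forget (α , cell , _ ∷ matches) = α , cell , matches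

        choose : ∀ {p} → Realised A p → Realised A ((e , true) ∷ p) ⊎ Realised A ((e , false) ∷ p)
        choose (α , cell@(_ , refl , _) , matches) with supp⇒sign α e∈A
        ... | true  , αe = inj₁ (α , cell , αe ∷ matches)
        ... | false , αe = inj₂ (α , cell , αe ∷ matches)

        visible-keys : ∀ {p} → p ∈ₗ patterns S → All (Visible A ∘ proj₁) p
        visible-keys p∈ = All.map⁻ (subst (All (Visible A)) (sym (patterns-keys S p∈)) vis)

      -- Double counting of pairs of a pattern and a matching cell: each pattern on all of Γ(A) has
      -- at most one matching cell, by `covector-unique`, and each cell matches exactly one pattern.
      T-full : ∀ {A} S → All (_∈ A) S → (∀ {e} → e ∈ A → e ∈ₗ S) →
        T A S ≡ ∑ covecs λ α → [ cell? A α ]· 1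
      T-full {A} S S⊆A A⊆S = trans (∑-cong-∈ (patterns S) at-most-one) (matched S S⊆A)
        where
        matched : ∀ S → All (_∈ A) S →
          ∑ (patterns S) (λ p → ∑ covecs λ α → [ matching? A p α ]· 1) ≡ ∑ covecs λ α → [ cell? A α ]· 1
        matched [] [] = trans (+-identityʳ _)
          (∑-cong covecs λ α → []·-cong (matching? A [] α) (cell? A α) proj₁ λ cell → cell , [])
        matched (e ∷ S) (e∈A ∷ S⊆A) = trans (∑-patterns e S _)
          (trans (∑-cong (patterns S) λ p → trans (sym (∑-∙ covecs _ _)) (∑-cong covecs λ α → sym (
              []·-⊎ (matching? A p α) (matching? A ((e , true) ∷ p) α) (matching? A ((e , false) ∷ p) α)
                choose
                (λ { (cell , _ ∷ matches) → cell , matches })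
                (λ { (cell , _ ∷ matches) → cell , matches })
                (λ { (_ , α⊕ ∷ _) (_ , α⊖ ∷ _) → contradiction (trans (sym α⊕) α⊖) λ () }))))
            (matched S S⊆A))
          where
          choose : ∀ {α p} → Cell A α × Matches α p →
            (Cell A α × Matches α ((e , true) ∷ p)) ⊎ (Cell A α × Matches α ((e , false) ∷ p))
          choose {α} (cell@(_ , refl , _) , matches) with supp⇒sign α e∈A
          ... | true  , αe = inj₁ (cell , αe ∷ matches)
          ... | false , αe = inj₂ (cell , αe ∷ matches)

        at-most-one : ∀ {p} → p ∈ₗ patterns S → [ realised? A p ]· 1 ≡ ∑ covecs λ α → [ matching? A p α ]· 1
        at-most-one {p} p∈ with realised? A p
        ... | no none = sym (∑-ε covecs λ α → []·-no (matching? A p α) λ match → none (α , match))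
        ... | yes (α , (cell@(α∈𝓛 , suppα , _) , matches)) =
          sym (∑-single (Vec-finite Sign-finite n) (matching? A p) (cell , matches)
            (λ { {β} ((β∈𝓛 , suppβ , _) , matches′) → covector-unique β∈𝓛 α∈𝓛 (trans suppβ (sym suppα)) λ e∈ →
              same β α p matches′ matches (subst (_ ∈ₗ_) (sym (patterns-keys S p∈)) (A⊆S (subst (_ ∈_) suppβ e∈))) })
            (λ _ → 1))
          where
          same : ∀ α β {e} p → Matches α p → Matches β p → e ∈ₗ map proj₁ p → lookup α e ≡ lookup β e
          same α β (_ ∷ p) (αe ∷ _) (βe ∷ _) (here refl) = trans αe (sym βe)
          same α β (_ ∷ p) (_ ∷ mα) (_ ∷ mβ) (there e∈p) = same α β p mα mβ e∈p

    -- Equality of the two counts, and counting chains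

    module Counting (m : Subset n → Subset n → ℤ)
      (m-refl : ∀ A → Flat A → m A A ≡ ℤ.1ℤ)
      (m-sum : ∀ B A → Flat B → Flat A → B ≼ A × B ≢ A →
        ∀ l → Enumerates l (λ C → Flat C × B ≼ C × C ≼ A) → sumℤ (map (m B) l) ≡ ℤ.0ℤ)
      where

      open Möbius m m-refl m-sum

      module _ {δ : Covec n} (δ∈𝓛 : 𝓛 δ) where
        open Above δ∈𝓛

        -- The flat varies in the induction, since the recursion refers to `A` and `A′`. Flats that
        -- do not lie above the support of `δ` have to be included, because `A′` may be one; both
        -- sides are then 0.
        T≡P : ∀ S {A} → Flat A → All (Visible A) S → T A S ≡ P (supp δ) A S
        T≡P [] {A} flatA [] with supp δ ≼? A
        ... | yes D≼A = trans (T-[]-≼ D≼A) (sym (P-[]-≼ D≼A))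
        ... | no D⋠A = trans (T-[]-⋠ D⋠A) (sym (P-empty {S = []}
                         λ D≼B ((_ , B≼C , C≼A) , _) → D⋠A (≼-trans D≼B (≼-trans B≼C C≼A))))
        T≡P (e ∷ S) {A} flatA (inj₂ e∈ξ ∷ vis) = trans (T-hidden S e∈ξ) (sym (P-empty {S = e ∷ S}
          λ { _ ((_ , _ , C≼A) , e∈C ∷ _) → ξ-disjoint e∈C (ξ-antitone C≼A e∈ξ) }))
        T≡P (e ∷ S) {A} flatA (inj₁ e∈A ∷ vis) with contract flatA e∈A
        ... | A′ , c = begin
          T A (e ∷ S)                       ≡⟨ T-∷ S flatA e∈A c vis ⟩
          T A S + T A′ S                    ≡⟨ cong₂ _+_ (T≡P S flatA vis) (T≡P S (Contraction.flat c)
                                                 (All.map (visible-≼ (Contraction.below c)) vis)) ⟩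
          P (supp δ) A S + P (supp δ) A′ S  ≡⟨ sym (P-∷ {S = S} flatA c vis) ⟩
          P (supp δ) A (e ∷ S)              ∎
          where open ≡-Reasoning

        cell-count : ∀ {A reps} → Flat A → Enumerates reps (λ C → Flat C × supp δ ≼ C × C ≼ A) →
          ∑ covecs (λ α → [ cell? A α ]· 1) ≡ sum (map (λ B → ∣ m B A ∣) reps)
        cell-count {A} flatA enum = trans (sym (T-full S S⊆A A⊆S))
          (trans (T≡P S flatA (All.map inj₁ S⊆A)) (P-full flatA S⊆A A⊆S enum))
          where
          S : List (Fin n)
          S = filter (_∈? A) (allFin n)

          S⊆A : All (_∈ A) S
          S⊆A = All.all-filter (_∈? A) (allFin n)

          A⊆S : ∀ {e} → e ∈ A → e ∈ₗ S
          A⊆S {e} = ∈-filter⁺ (_∈? A) (∈-allFin e)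

      Chain : ∀ {k} → Vec (Subset n) (suc k) → Vec (Covec n) (suc k) → Set
      Chain {k} A α = (∀ i → 𝓛 (lookup α i) × supp (lookup α i) ≡ lookup A i) ×
        (∀ (i : Fin k) → lookup α (fsuc i) ≺ lookup α (inject₁ i))
        where
        _≺_ : Covec n → Covec n → Set
        α ≺ β = (supp α ≼ supp β × (∀ e → e ∈ supp α → e ∈ supp β → lookup α e ≡ lookup β e)) × α ≢ β

      chain? : ∀ {k} (A : Vec (Subset n) (suc k)) → Decidable (Chain A)
      chain? A α = (Fin.all? λ i → 𝓛? (lookup α i) ×-dec ≡-dec Bool._≟_ (supp (lookup α i)) (lookup A i)) ×-dec
        (Fin.all? λ i → ((supp (lookup α (fsuc i)) ≼? supp (lookup α (inject₁ i))) ×-dec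
            Fin.all? λ e → (e ∈? supp (lookup α (fsuc i))) →-dec (e ∈? supp (lookup α (inject₁ i))) →-dec
              (lookup (lookup α (fsuc i)) e ≟ˢ lookup (lookup α (inject₁ i)) e)) ×-dec
          ¬? (≡-dec _≟ˢ_ (lookup α (fsuc i)) (lookup α (inject₁ i))))

      covecs^ : ∀ k → Finite (Vec (Covec n) k)
      covecs^ = Vec-finite (Vec-finite Sign-finite n)

      chain-∷⁻ : ∀ {k A₀ α₀} {A : Vec (Subset n) (suc k)} {α} → Chain (A₀ ∷ A) (α₀ ∷ α) → Chain A α
      chain-∷⁻ (cells , desc) = cells ∘ fsuc , desc ∘ fsuc

      -- Once the tail is known to be a chain, only the comparison with its first covector remains;
      -- its strictness follows from the supports being different.
      chain-∷⇔ : ∀ {k A₀} {A : Vec (Subset n) (suc k)} {α₀ α} → lookup A fzero ≢ A₀ →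
        (chain : Chain A α) → Chain (A₀ ∷ A) (α₀ ∷ α) ⇔ Above.Cell (proj₁ (proj₁ chain fzero)) A₀ α₀
      chain-∷⇔ {A₀ = A₀} {A} {α₀} {α} A₁≢A₀ chain@(cells , desc) = mk⇔
        (λ (cells′ , desc′) → proj₁ (cells′ fzero) , proj₂ (cells′ fzero) , proj₁ (desc′ fzero))
        (λ (α₀∈𝓛 , suppα₀ , above) →
          (λ { fzero → α₀∈𝓛 , suppα₀ ; (fsuc i) → cells i }) ,
          (λ { fzero → above , (λ eq → A₁≢A₀ (trans (sym (proj₂ (cells fzero))) (trans (cong supp eq) suppα₀)))
             ; (fsuc i) → desc i }))

      -- By `cell-count`, the number of possible heads depends on the tail only through the support
      -- of its first covector, which is prescribed. Summing over heads inside and tails outside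
      -- therefore pulls out a constant factor.
      chain-count : ∀ k (A : Vec (Subset n) (suc k)) → (∀ i → Flat (lookup A i)) →
        (∀ (i : Fin k) → lookup A (fsuc i) ≢ lookup A (inject₁ i)) →
        (∀ {e} → e ∉ lookup A (fromℕ k)) →
        (reps : Fin k → List (Subset n)) →
        (∀ i → Enumerates (reps i) (λ C → Flat C × lookup A (fsuc i) ≼ C × C ≼ lookup A (inject₁ i))) →
        ∑ (Finite.elements (covecs^ (suc k))) (λ α → [ chain? A α ]· 1) ≡
        product (map (λ i → sum (map (λ B → ∣ m B (lookup A (inject₁ i)) ∣) (reps i))) (allFin k))
      chain-count 0 (A ∷ []) flats _ bottom reps enum with supp-onto A (flats fzero)
      -- Γ of the bottom flat is empty, so no sign is left to choose and exactly one covector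
      -- exists.
      ... | α , α∈𝓛 , refl = ∑-single (covecs^ 1) (chain? (A ∷ [])) {α ∷ []}
        ((λ { fzero → α∈𝓛 , refl }) , λ ())
        (λ { {β ∷ []} (cells , _) → cong (_∷ []) (covector-unique (proj₁ (cells fzero)) α∈𝓛 (proj₂ (cells fzero))
               λ e∈β → contradiction (subst (_ ∈_) (proj₂ (cells fzero)) e∈β) bottom) })
        (λ _ → 1)
      chain-count (suc k) (A₀ ∷ A) flats strict bottom reps enum = begin
        ∑ (cartesianProductWith _∷_ covecs tails) (λ α → [ chain? (A₀ ∷ A) α ]· 1)
          ≡⟨ ∑-cartesianProductWith _∷_ covecs tails _ ⟩
        ∑ covecs (λ α₀ → ∑ tails λ α → [ chain? (A₀ ∷ A) (α₀ ∷ α) ]· 1)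
          ≡⟨ ∑-swap covecs tails _ ⟩
        ∑ tails (λ α → ∑ covecs λ α₀ → [ chain? (A₀ ∷ A) (α₀ ∷ α) ]· 1)
          ≡⟨ ∑-cong tails extensions ⟩
        ∑ tails (λ α → c fzero * [ chain? A α ]· 1)
          ≡⟨ ∑-*ˡ (c fzero) tails _ ⟩
        c fzero * ∑ tails (λ α → [ chain? A α ]· 1)
          ≡⟨ cong (c fzero *_) (chain-count k A (flats ∘ fsuc) (strict ∘ fsuc) bottom (reps ∘ fsuc) (enum ∘ fsuc)) ⟩
        c fzero * product (map (c ∘ fsuc) (allFin k))
          ≡⟨ cong (λ l → c fzero * product l) (trans (map-tabulate id (c ∘ fsuc)) (sym (map-tabulate fsuc c))) ⟩
        product (map c (allFin (suc k))) ∎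
        where
        open ≡-Reasoning
        tails : List (Vec (Covec n) (suc k))
        tails = Finite.elements (covecs^ (suc k))

        c : Fin (suc k) → ℕ
        c i = sum (map (λ B → ∣ m B (lookup (A₀ ∷ A) (inject₁ i)) ∣) (reps i))

        extensions : ∀ α → ∑ covecs (λ α₀ → [ chain? (A₀ ∷ A) (α₀ ∷ α) ]· 1) ≡ c fzero * [ chain? A α ]· 1
        extensions α with chain? A α
        ... | no ¬chain = trans (∑-ε covecs λ α₀ → []·-no (chain? (A₀ ∷ A) (α₀ ∷ α)) (¬chain ∘ chain-∷⁻))
                (sym (*-zeroʳ (c fzero)))
        ... | yes chain = trans
          (∑-cong covecs λ α₀ → []·-cong (chain? (A₀ ∷ A) (α₀ ∷ α)) (Above.cell? α₁∈𝓛 A₀ α₀)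
            (to (chain-∷⇔ (strict fzero) chain)) (from (chain-∷⇔ (strict fzero) chain)))
          (trans (cell-count α₁∈𝓛 (flats fzero) (subst (λ D → Enumerates (reps fzero) (λ C → Flat C × D ≼ C × C ≼ A₀))
                    (sym (proj₂ (proj₁ chain fzero))) (enum fzero)))
                 (sym (*-identityʳ (c fzero))))
          where
          α₁∈𝓛 : 𝓛 (lookup α fzero)
          α₁∈𝓛 = proj₁ (proj₁ chain fzero)

-- Passing to oriented interval greedoids

module _ {n : ℕ} (F : Subset n → Bool) where

  ∈Γ⁺ : ∀ {X e} → e ∉ X → Feasible F (X ▹ e) → e ∈ Γ F X
  ∈Γ⁺ {X} {e} e∉X Fe = lookup⇒[]= e _ (trans (lookup∘tabulate _ e) (both (lookup X e) refl Fe))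
    where
    both : ∀ b → lookup X e ≡ b → F (X ▹ e) ≡ true → not b ∧ F (X ▹ e) ≡ true
    both true  eq _ = contradiction (lookup⇒[]= e X eq) e∉X
    both false _  p = p

  ∈Γ⁻ : ∀ {X e} → e ∈ Γ F X → e ∉ X × Feasible F (X ▹ e)
  ∈Γ⁻ {X} {e} e∈Γ = split (lookup X e) refl (trans (sym (lookup∘tabulate _ e)) ([]=⇒lookup e∈Γ))
    where
    split : ∀ b → lookup X e ≡ b → not b ∧ F (X ▹ e) ≡ true → e ∉ X × Feasible F (X ▹ e)
    split false eq p = (λ e∈X → contradiction (trans (sym eq) ([]=⇒lookup e∈X)) λ ()) , p
    split true _ ()

module Oriented {n : ℕ} (F : Subset n → Bool) (𝓛 : Covec n → Set)
  (isOriented : IsOrientedIntervalGreedoid F 𝓛) where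

  open IsOrientedIntervalGreedoid isOriented
  open IsIntervalGreedoid greedoid
  open IntervalGreedoid (Feasible F) (λ X → F X Bool.≟ true) (Γ F) (∈Γ⁺ F) (∈Γ⁻ F) IG1 IG2 IG3 public

  supp-flat : ∀ {α} → 𝓛 α → Flat (supp α)
  supp-flat α∈𝓛 = proj₁ (covectors _ α∈𝓛)

  zero⇔ : ∀ {α} → 𝓛 α → ∀ e → lookup α e ≡ 𝟎 ⇔ e inξ supp α
  zero⇔ α∈𝓛 = proj₂ (covectors _ α∈𝓛)

  -- When supp α ≤ supp β the join of the two supports is supp β.
  comparable-product : ∀ {α β γ} → 𝓛 β → supp α ≼ supp β →
    (∀ e → e ∈ supp β ⊎ e inξ supp β → lookup γ e ≡ pick (lookup α e) (lookup β e)) →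
    (∀ e → lookup β e ≡ 𝟏 → lookup γ e ≡ 𝟏) →
    IsProduct F α β γ
  comparable-product {α} {β} {γ} β∈𝓛 α≼β visible hidden with ≼⇒flatʳ α≼β
  ... | X , FX , eq = X ,
    subst (λ B → MaxFeasibleIn F (λ e → e inξ supp α × e inξ B) X) eq
      (basis-maximal FX (subst (supp α ≼_) (sym eq) α≼β)) ,
    subst (λ B → ∀ e → e ∈ B ⊎ e inξ B → lookup γ e ≡ pick (lookup α e) (lookup β e)) (sym eq) visible ,
    subst (λ B → ∀ e → ¬ (e ∈ B ⊎ e inξ B) → lookup γ e ≡ 𝟏) (sym eq)
      λ e ¬visible → hidden e (neither⇒𝟏 β (¬visible ∘ inj₁) (¬visible ∘ inj₂ ∘ to (zero⇔ β∈𝓛 e)))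

  -- On Γ(supp β) the covector `α` has a sign, which is kept, or is zero, which lets the sign of `β`
  -- through. A zero of `β` is also a zero of `α`, and `𝟏` absorbs everything; hence the product has
  -- the support of `β`.
  compose : ∀ {α β} → 𝓛 α → 𝓛 β → supp α ≼ supp β →
    ∃[ γ ] (𝓛 γ × supp γ ≡ supp β × ∀ e → lookup γ e ≡ pick (lookup α e) (lookup β e))
  compose {α} {β} α∈𝓛 β∈𝓛 α≼β =
    γ , OG3 α β γ α∈𝓛 β∈𝓛 (comparable-product {γ = γ} β∈𝓛 α≼β (λ e _ → γ≡ e) 𝟏⇒𝟏) , supp-cong γ β isPM≡ , γ≡
    where
    γ : Covec n
    γ = zipWith pick α β

    γ≡ : ∀ e → lookup γ e ≡ pick (lookup α e) (lookup β e)
    γ≡ e = lookup-zipWith pick e α β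

    𝟏⇒𝟏 : ∀ e → lookup β e ≡ 𝟏 → lookup γ e ≡ 𝟏
    𝟏⇒𝟏 e eq = trans (γ≡ e) (trans (cong (pick (lookup α e)) eq) (pick-𝟏 (lookup α e)))
      where
      pick-𝟏 : ∀ s → pick s 𝟏 ≡ 𝟏
      pick-𝟏 𝟎 = refl
      pick-𝟏 ⊕ = refl
      pick-𝟏 ⊖ = refl
      pick-𝟏 𝟏 = refl

    isPM≡ : ∀ e → isPM (lookup γ e) ≡ isPM (lookup β e)
    isPM≡ e with e ∈? supp β
    ... | yes e∈β with supp⇒sign β e∈β | ∈-or-inξ α≼β e∈β
    ...   | _ | inj₁ e∈α = trans (cong isPM (trans (γ≡ e) (pick-supp α β e∈α e∈β)))
                             (trans (isPM-supp α e∈α) (sym (isPM-supp β e∈β)))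
    ...   | _ | inj₂ e∈ξ = cong isPM (trans (γ≡ e) (cong (λ s → pick s (lookup β e)) (from (zero⇔ α∈𝓛 e) e∈ξ)))
    isPM≡ e | no e∉β with lookup β e ≟ˢ 𝟎
    ... | yes βe≡𝟎 = cong isPM (trans (γ≡ e) (trans
            (cong (λ s → pick s (lookup β e)) (from (zero⇔ α∈𝓛 e) (ξ-antitone α≼β (to (zero⇔ β∈𝓛 e) βe≡𝟎)))) refl))
    ... | no βe≢𝟎 = cong isPM (trans (𝟏⇒𝟏 e βe≡𝟏) (sym βe≡𝟏))
      where
      βe≡𝟏 : lookup β e ≡ 𝟏
      βe≡𝟏 = neither⇒𝟏 β e∉β βe≢𝟎

  same-support-product : ∀ {α β} → 𝓛 α → 𝓛 β → supp α ≡ supp β → IsProduct F α β α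
  same-support-product {α} {β} α∈𝓛 β∈𝓛 eq = comparable-product {γ = α} β∈𝓛
    (subst (supp α ≼_) eq (≼-refl (supp-flat α∈𝓛))) visible
    λ e βe≡𝟏 → neither⇒𝟏 α (λ e∈α → sign≢ (supp⇒sign β (subst (e ∈_) eq e∈α)) βe≡𝟏)
      (λ αe≡𝟎 → contradiction (trans (sym (β≡𝟎 (to (zero⇔ α∈𝓛 e) αe≡𝟎))) βe≡𝟏) λ ())
    where
    β≡𝟎 : ∀ {e} → e inξ supp α → lookup β e ≡ 𝟎
    β≡𝟎 {e} e∈ξ = from (zero⇔ β∈𝓛 e) (subst (e inξ_) eq e∈ξ)

    sign≢ : ∀ {s} → ∃[ b ] s ≡ sign b → s ≢ 𝟏
    sign≢ (true , refl) ()
    sign≢ (false , refl) ()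

    visible : ∀ e → e ∈ supp β ⊎ e inξ supp β → lookup α e ≡ pick (lookup α e) (lookup β e)
    visible e (inj₁ e∈β) = sym (pick-supp α β (subst (e ∈_) (sym eq) e∈β) e∈β)
    visible e (inj₂ e∈ξ) = trans αe≡𝟎 (sym (cong₂ pick αe≡𝟎 (from (zero⇔ β∈𝓛 e) e∈ξ)))
      where
      αe≡𝟎 : lookup α e ≡ 𝟎
      αe≡𝟎 = from (zero⇔ α∈𝓛 e) (subst (e inξ_) (sym eq) e∈ξ)

  eliminate : ∀ {α β e} → 𝓛 α → 𝓛 β → supp α ≡ supp β → Sep α β e →
    ∃[ γ ] (𝓛 γ × lookup γ e ≡ 𝟎 × ∀ f → ¬ Sep α β f → lookup α f ≢ 𝟏 → lookup γ f ≡ lookup α f)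
  eliminate {α} {β} {e} α∈𝓛 β∈𝓛 eq sep
    -- For equal supports `α ∘ β = α` and `β ∘ α = β`; these are the two products passed to `OG4`.
    with OG4 α β e α β α∈𝓛 β∈𝓛 sep (same-support-product α∈𝓛 β∈𝓛 eq)
           (same-support-product β∈𝓛 α∈𝓛 (sym eq)) (≢𝟏 sep)
    where
    ≢𝟏 : Sep α β e → lookup α e ≢ 𝟏
    ≢𝟏 (inj₁ (αe , _)) = subst (_≢ 𝟏) (sym αe) λ ()
    ≢𝟏 (inj₂ (αe , _)) = subst (_≢ 𝟏) (sym αe) λ ()
  ... | γ , γ∈𝓛 , γe , γ≡ = γ , γ∈𝓛 , γe , λ f ¬sep αf≢𝟏 → proj₁ (γ≡ f ¬sep αf≢𝟏)

mainTheorem3 : ∀ {n : ℕ} (F : Subset n → Bool) (𝓛 : Covec n → Set) →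
    IsOrientedIntervalGreedoid F 𝓛 →
    (m : Subset n → Subset n → ℤ) → IsMobius F m →
    (k : ℕ) (A : Vec (Subset n) (suc k)) →
    (∀ i → IsFlat F (lookup A i)) →
    (∀ (i : Fin k) → _<Φ_ F (lookup A (fsuc i)) (lookup A (inject₁ i))) →
    IsBottom F (lookup A (fromℕ k)) →
    (tuples : List (Vec (Covec n) (suc k))) →
    Enumerates tuples (λ α → (∀ i → 𝓛 (lookup α i) × supp (lookup α i) ≡ lookup A i) ×
    (∀ (i : Fin k) → _<ᶜ_ F (lookup α (fsuc i)) (lookup α (inject₁ i)))) →
    (reps : Fin k → List (Subset n)) →
    (∀ i → Enumerates (reps i) (InInterval F (lookup A (fsuc i)) (lookup A (inject₁ i)))) →
    length tuples ≡ product (map (λ i → sum (map (λ B → ∣ m B (lookup A (inject₁ i)) ∣) (reps i))) (allFin k))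
mainTheorem3 {n} F 𝓛 isOriented m (m-refl , m-sum) k A flats strict (flat , least) tuples enum reps enum-reps =
  -- The goal is decidable, so 𝓛 may be assumed decidable.
  decidable-stable (_ ℕ.≟ _) λ ≢ → Finite.¬¬-decidable (Vec-finite Sign-finite n) 𝓛 (≢ ∘ count)
  where
  open Oriented F 𝓛 isOriented
  open IsOrientedIntervalGreedoid isOriented using (OG1; OG2)

  count : Decidable 𝓛 → length tuples ≡
    product (map (λ i → sum (map (λ B → ∣ m B (lookup A (inject₁ i)) ∣) (reps i))) (allFin k))
  count 𝓛? = begin
    length tuples                                                       ≡⟨ length≡∑ tuples ⟩
    ∑ tuples (λ _ → 1)
      ≡⟨ ∑-enumerates (covecs^ (suc k)) (chain? A) enum _ ⟩
    ∑ (Finite.elements (covecs^ (suc k))) (λ α → [ chain? A α ]· 1)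
      ≡⟨ chain-count k A flats (proj₂ ∘ strict) (bottom⇒∉ flat least) reps enum-reps ⟩
    product (map (λ i → sum (map (λ B → ∣ m B (lookup A (inject₁ i)) ∣) (reps i))) (allFin k)) ∎
    where
    open ≡-Reasoning
    open Covectors 𝓛 𝓛? supp-flat zero⇔ OG1 OG2 compose eliminate
    open Counting m m-refl m-sum
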